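{- Let $p$ be an odd prime and let $d\in\mathbb{Z}$ with $\left(\frac{ -d}{p}\right)=-1$. For an integer $m\ge 0$ put $S_m(d,p)=\det\left[(j^2+dk^2)^m\right]_{1\le j,k\le (p-1)/2}$. (i) We have $\left(\frac{S_{p-2}(d,p)}{p}\right)=\left(\frac 2p\right)$. Moreover, $$\det\left[\frac1{j^2+dk^2}\right]_{1\le j,k\le (p-1)/2}\equiv\begin{cases}d^{(p-1)/4}\pmod p&\text{if } p\equiv1\pmod4,\\(-1)^{(p+1)/4}\pmod p&\text{if } p\equiv3\pmod4.\end{cases}$$ (ii) We have $\left(\frac{S_{p-3}(d,p)}{p}\right)=\frac{1-\left(\frac{ -1}{p}\right)}{2}$. Moreover, when $p\equiv3\pmod4$, $$\det\left[\frac1{(j^2+dk^2)^2}\right]_{1\le j,k\le (p-1)/2}\equiv\frac14\prod_{r=1}^{(p-3)/4}\left(r+\frac14\right)^2\pmod p.$$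
   Context: $\left(\frac{\cdot}{p}\right)$ is the Legendre symbol. Since $\left(\frac{ -d}{p}\right)=-1$, no $j^2+dk^2$ with $1\le j,k\le(p-1)/2$ is divisible by $p$, so the determinants above are rational numbers whose denominators are prime to $p$; congruences modulo $p$ between such rationals are understood in the ring of rationals with denominator prime to $p$. -}

module Defs where

open import Algebra.Bundles using (RawRing)
import Algebra.Definitions.RawSemiring as RawSemiringDefs
open import Data.Bool.Base using (if_then_else_)
open import Data.Fin.Base using (Fin; zero; suc; toℕ; punchIn)
open import Data.Fin.Properties using (any?)
open import Data.Integer.Base using (ℤ; +_; -[1+_]; 0ℤ; 1ℤ; -1ℤ)
import Data.Integer.Base as ℤ
open import Data.Integer.Divisibility.Signed using (_∣_; _∣?_)
open import Data.Nat.Base using (ℕ; zero; suc; _∸_)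
import Data.Nat.Base as ℕ
open import Data.Nat.Coprimality using (Coprime)
import Data.Nat.DivMod as ℕ
open import Data.Product.Base using (_×_; ∃-syntax)
open import Data.Rational.Base using (ℚ; 0ℚ; _/_; ↧ₙ_)
import Data.Rational.Base as ℚ
open import Relation.Binary.PropositionalEquality using (_≡_)
open import Relation.Nullary.Decidable using (Dec; ⌊_⌋)

open RawSemiringDefs ℚ.+-*-rawSemiring public
  using () renaming (_^_ to _^ℚ_; product to productℚ)

module _ {c ℓ} (R : RawRing c ℓ) where
  open RawRing R
  open RawSemiringDefs rawSemiring using (sum; _^_)

  -- Laplace expansion along the first row.
  det : ∀ {n} → (Fin n → Fin n → Carrier) → Carrier
  det {zero}  M = 1#
  det {suc n} M = sum λ k →
    ((- 1#) ^ toℕ k) * (M zero k * det (λ i j → M (suc i) (punchIn k j)))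

detℤ : ∀ {n} → (Fin n → Fin n → ℤ) → ℤ
detℤ = det ℤ.+-*-rawRing

detℚ : ∀ {n} → (Fin n → Fin n → ℚ) → ℚ
detℚ = det ℚ.+-*-rawRing

IsSquareMod : ℤ → ℕ → Set
IsSquareMod a p = ∃[ x ] + p ∣ (+ toℕ {p} x) ℤ.^ 2 ℤ.- a

isSquareMod? : ∀ a p → Dec (IsSquareMod a p)
isSquareMod? a p = any? λ x → + p ∣? (+ toℕ {p} x) ℤ.^ 2 ℤ.- a

legendre : ℤ → ℕ → ℤ
legendre a p =
  if ⌊ + p ∣? a ⌋ then 0ℤ else
  if ⌊ isSquareMod? a p ⌋ then 1ℤ else -1ℤ

-- The inverse of a nonzero integer; the value at 0 is a convention.  It is
-- only applied to powers of j² + dk² with 1 ≤ j,k ≤ (p - 1)/2, which are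
-- nonzero (indeed prime to p) when legendre (- d) p ≡ -1ℤ.
recip : ℤ → ℚ
recip (+ zero)      = 0ℚ
recip (+ n@(suc _)) = 1ℤ / n
recip -[1+ n ]      = -1ℤ / suc n

half : ℕ → ℕ
half p = (p ∸ 1) ℕ./ 2

-- The index i : Fin (half p) stands for the integer toℕ i + 1, so that the
-- indices run over 1, …, (p - 1)/2.
form : ∀ {p} → ℤ → Fin (half p) → Fin (half p) → ℤ
form d j k = (+ suc (toℕ j)) ℤ.^ 2 ℤ.+ d ℤ.* (+ suc (toℕ k)) ℤ.^ 2

S : ℕ → ℤ → ℕ → ℤ
S m d p = detℤ λ j k → form {p} d j k ℤ.^ m

-- det [ 1/(j² + dk²)^m ]
invDet : ℕ → ℤ → ℕ → ℚ
invDet m d p = detℚ λ j k → recip (form {p} d j k ℤ.^ m)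

-- ∏₁ n f = f 1 · f 2 ⋯ f n
∏₁ : ℕ → (ℕ → ℚ) → ℚ
∏₁ n f = productℚ {n} λ i → f (suc (toℕ i))

Integralₚ : ℕ → ℚ → Set
Integralₚ p x = Coprime (↧ₙ x) p

-- Congruence modulo the ideal generated by p in the ring of rationals with
-- denominator prime to p; both sides are required to lie in this ring.
infix 4 _≈_[mod_]
_≈_[mod_] : ℚ → ℚ → ℕ → Set
x ≈ y [mod p ] =
  Integralₚ p x × Integralₚ p y ×
  (∃[ z ] Integralₚ p z × x ℚ.- y ≡ (+ p / 1) ℚ.* z)

{-# OPTIONS --safe #-}
module Submission where

-- Let n = (p - 1)/2, e = -d, and let x₁, …, xₙ be the squares 1², …, n²; modulo
-- p they are the roots of Tⁿ - 1, while eⁿ = -1.  For x = xⱼ and y = e xₖ this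
-- turns 1/(x - y) and 1/(x - y)² into homogeneous polynomials in x and y:
--   1/(x - y)  = 1/2 Σ_{i<n} x^(n-1-i) yⁱ,
--   1/(x - y)² = 1/4 x^(n-1) Σ_{i<n} (2i + 2 - n) x^(n-1-i) yⁱ.
-- Hence both matrices have the form D A C B with A = (xⱼ^(n-1-i)), B = (xₖⁱ) and
-- D, C diagonal, and A B is diagonal with entries n xⱼ^(n-1), because
-- Σ_i xⱼ^(n-1-i) xₖⁱ = 0 for j ≠ k.  So the determinants are explicit products.
-- They are evaluated with ∏ xⱼ = (-1)^(n+1), read off from Tⁿ - 1 = ∏ (T - xⱼ),
-- Euler's criterion and, for (2/p), (1 + i)² = 2i when p ≡ 1 (mod 4) and Gauss's
-- lemma when p ≡ 3 (mod 4).

open import Defs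
open import Algebra.Bundles using (RawRing; CommutativeRing; Semiring)
import Algebra.Definitions.RawSemiring as RawSemiringDefs
import Algebra.Properties.CommutativeSemiring.Binomial as Binomial
import Algebra.Properties.Semiring.Sum as Sum
open import Data.Empty using (⊥-elim)
open import Data.Fin.Base using (Fin; zero; suc; toℕ; punchIn; inject₁; fromℕ; fromℕ<)
import Data.Fin.Properties as Fin
open import Data.Nat.Base as ℕ using (ℕ; zero; suc; 2+; _∸_; _%_; _≤_; _<_; z≤n; s≤s; z<s; s<s; _!)
open import Data.Nat.Combinatorics using (_C_; nCk≡n!/k![n-k]!; nCk≡nC[n∸k]; k![n∸k]!∣n!; nCn≡1)
import Data.Nat.Coprimality as Coprimality
open import Data.Nat.Divisibility as ℕ using (_∤_)
import Data.Nat.DivMod as ℕ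
open import Data.Nat.Primality using (Prime; euclidsLemma; prime⇒nonZero; prime⇒nonTrivial; prime⇒irreducible; ¬prime[1])
import Data.Nat.Properties as ℕ
import Data.Nat.Solver as ℕ
open import Data.Product.Base using (_×_; _,_; proj₁; proj₂; ∃-syntax)
open import Data.Sum.Base using (_⊎_; inj₁; inj₂; [_,_]′)
open import Data.Vec.Functional using (Vector; tail; removeAt)
open import Function.Base using (_∘_)
open import Level using (0ℓ; _⊔_)
open import Relation.Binary.Definitions using (tri<; tri≈; tri>)
open import Relation.Binary.PropositionalEquality as ≡ using (_≡_; _≢_)
open import Relation.Nullary using (¬_; yes; no)

-- Determinants over a commutative ring

-- One determinant modulo `p` serves the integer and the rational claims. With f = j² + dk², Fermat
-- gives f^m f^(p-1-m) = 1, so for m = 1, 2 the matrix of 1/f^m reduces to the matrix of f^(p-1-m),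
-- whose determinant is `S (p ∸ 2)` or `S (p ∸ 3)`. The residue field is never constructed: its
-- elements are integers up to congruence, and (p + 1)/2 plays the role of 1/2. A and B are
-- Vandermonde matrices whose own determinants carry signs that are awkward to determine; they enter
-- only through A B. The price is the multiplicativity of `det`, derived here from the Laplace
-- expansion along the first row. The coefficients 2i + 2 - n decide the second part. For n even one
-- of them is 0. For n odd they are odd numbers symmetric about 0, apart from the last one, n, so
-- their product is a square up to a sign and the factor n.

module _ {a b ℓ₁ ℓ₂} (R₁ : RawRing a ℓ₁) (R₂ : RawRing b ℓ₂) where
  private
    module R₁ = RawRing R₁
    module R₂ = RawRing R₂
    module S₁ = RawSemiringDefs R₁.rawSemiring
    module S₂ = RawSemiringDefs R₂.rawSemiring

  -- A relation rather than a homomorphism, because reduction modulo `p` is defined only on part of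
  -- ℚ. It is used for the congruence of a ring with itself, for the passage from ℤ to ℤ modulo `p`,
  -- and for the passage from rationals to residues.
  record IsRingRelation {ℓ} (_~_ : R₁.Carrier → R₂.Carrier → Set ℓ) : Set (a ⊔ b ⊔ ℓ) where
    field
      0~0 : R₁.0# ~ R₂.0#
      1~1 : R₁.1# ~ R₂.1#
      -~- : ∀ {x y} → x ~ y → (R₁.- x) ~ (R₂.- y)
      +~+ : ∀ {x y x′ y′} → x ~ y → x′ ~ y′ → (x R₁.+ x′) ~ (y R₂.+ y′)
      *~* : ∀ {x y x′ y′} → x ~ y → x′ ~ y′ → (x R₁.* x′) ~ (y R₂.* y′)

    sum-rel : ∀ {n} {f : Vector R₁.Carrier n} {g : Vector R₂.Carrier n} →
              (∀ i → f i ~ g i) → S₁.sum f ~ S₂.sum g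
    sum-rel {zero}  f~g = 0~0
    sum-rel {suc n} f~g = +~+ (f~g zero) (sum-rel (f~g ∘ suc))

    product-rel : ∀ {n} {f : Vector R₁.Carrier n} {g : Vector R₂.Carrier n} →
                  (∀ i → f i ~ g i) → S₁.product f ~ S₂.product g
    product-rel {zero}  f~g = 1~1
    product-rel {suc n} f~g = *~* (f~g zero) (product-rel (f~g ∘ suc))

    ^-rel : ∀ {x y} n → x ~ y → (x S₁.^ n) ~ (y S₂.^ n)
    ^-rel zero    x~y = 1~1
    ^-rel (suc n) x~y = *~* x~y (^-rel n x~y)

    det-rel : ∀ {n} {M : Fin n → Fin n → R₁.Carrier} {N : Fin n → Fin n → R₂.Carrier} →
              (∀ i j → M i j ~ N i j) → det R₁ M ~ det R₂ N
    det-rel {zero}  M~N = 1~1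
    det-rel {suc n} M~N = sum-rel λ k →
      *~* (^-rel (toℕ k) (-~- 1~1)) (*~* (M~N zero k) (det-rel λ i j → M~N (suc i) (punchIn k j)))

-- Deleting columns `k` and `k′` in either order leaves the same columns in the same order; `l` and
-- `l′` are the positions of the second column once the first is gone.
punchIn-swap : ∀ {n} (k : Fin (suc (suc n))) (l : Fin (suc n)) k′ l′ (i : Fin n) →
               punchIn k l ≡ k′ → punchIn k′ l′ ≡ k →
               punchIn k (punchIn l i) ≡ punchIn k′ (punchIn l′ i)
punchIn-swap zero    l       _ zero     i       ≡.refl _ = ≡.refl
punchIn-swap (suc k) zero    _ l′       i       ≡.refl ≡.refl = ≡.refl
punchIn-swap (suc k) (suc l) _ (suc l′) zero    ≡.refl eq = ≡.refl
punchIn-swap (suc k) (suc l) _ (suc l′) (suc i) ≡.refl eq =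
  ≡.cong suc (punchIn-swap k l _ l′ i ≡.refl (Fin.suc-injective eq))

module Determinant {c ℓ} (R : CommutativeRing c ℓ) where
  open CommutativeRing R hiding (zero)
  open import Data.Vec.Functional using (_∷_)
  open import Algebra.Properties.Semiring.Sum semiring
    using (sum; sum-cong-≋; sum-remove; sum-replicate-zero; ∑-distrib-+; *-distribˡ-sum; *-distribʳ-sum)
  open import Algebra.Properties.Semiring.Exp semiring using (_^_)
  open import Algebra.Properties.Ring ring using (-‿distribˡ-*; -‿distribʳ-*; -‿involutive; -0#≈0#; +-inverseˡ-unique)
  open import Algebra.Properties.AbelianGroup +-abelianGroup using () renaming (⁻¹-∙-comm to -‿+-comm)
  open import Algebra.Properties.CommutativeSemigroup *-commutativeSemigroup
    using (x∙yz≈y∙xz; interchange)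
  open import Algebra.Properties.CommutativeSemigroup +-commutativeSemigroup
    using () renaming (interchange to +-interchange)
  open import Algebra.Properties.CommutativeMonoid.Sum *-commutativeMonoid
    using () renaming (sum to product)
  open import Relation.Binary.Reasoning.Setoid setoid

  Matrix : ℕ → ℕ → Set c
  Matrix m n = Fin m → Fin n → Carrier

  sgn : ∀ {n} → Fin n → Carrier
  sgn k = (- 1#) ^ toℕ k

  dropColumn : ∀ {m n} → Fin (suc n) → Matrix m (suc n) → Matrix m n
  dropColumn k M i = removeAt (M i) k

  ≈-isRingRelation : IsRingRelation rawRing rawRing _≈_
  ≈-isRingRelation = record { 0~0 = refl ; 1~1 = refl ; -~- = -‿cong ; +~+ = +-cong ; *~* = *-cong }

  open IsRingRelation ≈-isRingRelation using (det-rel)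

  -- Opaque, so that unification can solve for the argument of a sum and of a
  -- determinant.
  opaque
    ∑ : ∀ {n} → Vector Carrier n → Carrier
    ∑ = sum

    ∑-zero : ∀ (f : Vector Carrier 0) → ∑ f ≈ 0#
    ∑-zero f = refl

    ∑-suc : ∀ {n} (f : Vector Carrier (suc n)) → ∑ f ≈ f zero + ∑ (tail f)
    ∑-suc f = refl

    ∑-cong : ∀ {n} {f g : Vector Carrier n} → (∀ i → f i ≈ g i) → ∑ f ≈ ∑ g
    ∑-cong = sum-cong-≋

    ∑-0 : ∀ {n} {f : Vector Carrier n} → (∀ i → f i ≈ 0#) → ∑ f ≈ 0#
    ∑-0 {n} f≈0 = trans (sum-cong-≋ f≈0) (sum-replicate-zero n)

    ∑-+ : ∀ {n} (f g : Vector Carrier n) → ∑ (λ i → f i + g i) ≈ ∑ f + ∑ g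
    ∑-+ = ∑-distrib-+

    *-∑ : ∀ {n} x (f : Vector Carrier n) → ∑ (λ i → x * f i) ≈ x * ∑ f
    *-∑ x f = sym (*-distribˡ-sum x f)

    ∑-* : ∀ {n} x (f : Vector Carrier n) → ∑ (λ i → f i * x) ≈ ∑ f * x
    ∑-* x f = sym (*-distribʳ-sum x f)

    ∑-remove : ∀ {n} (k : Fin (suc n)) (f : Vector Carrier (suc n)) → ∑ f ≈ ∑ (removeAt f k) + f k
    ∑-remove k f = trans (sum-remove {i = k} f) (+-comm _ _)

  -‿∑ : ∀ {n} (f : Vector Carrier n) → ∑ (λ i → - f i) ≈ - ∑ f
  -‿∑ {zero}  f = trans (∑-zero _) (sym (trans (-‿cong (∑-zero f)) -0#≈0#))
  -‿∑ {suc n} f = begin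
    ∑ (λ i → - f i)                       ≈⟨ ∑-suc _ ⟩
    - f zero + ∑ (λ i → - f (suc i))      ≈⟨ +-congˡ (-‿∑ (tail f)) ⟩
    - f zero + - ∑ (tail f)               ≈⟨ -‿+-comm _ _ ⟩
    - (f zero + ∑ (tail f))               ≈⟨ -‿cong (∑-suc f) ⟨
    - ∑ f                                 ∎

  opaque
    unfolding ∑

    ∥_∥ : ∀ {n} → Matrix n n → Carrier
    ∥_∥ = det rawRing

    ∥∥≡det : ∀ {n} (M : Matrix n n) → ∥ M ∥ ≡ det rawRing M
    ∥∥≡det M = ≡.refl

    det-zero : ∀ (M : Matrix 0 0) → ∥ M ∥ ≈ 1#
    det-zero M = refl

    laplace : ∀ {n} (M : Matrix (suc n) (suc n)) →
              ∥ M ∥ ≈ ∑ λ k → sgn k * (M zero k * ∥ dropColumn k (tail M) ∥)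
    laplace M = refl

    det-cong : ∀ {n} {M N : Matrix n n} → (∀ i j → M i j ≈ N i j) → ∥ M ∥ ≈ ∥ N ∥
    det-cong = det-rel

  laplace-∷ : ∀ {n} v (Z : Matrix n (suc n)) →
              ∥ v ∷ Z ∥ ≈ ∑ λ k → sgn k * (v k * ∥ dropColumn k Z ∥)
  laplace-∷ v Z = laplace (v ∷ Z)

  det-∷ : ∀ {n} (M : Matrix (suc n) (suc n)) → ∥ M ∥ ≈ ∥ M zero ∷ tail M ∥
  det-∷ M = trans (laplace M) (sym (laplace-∷ (M zero) (tail M)))

  infixl 7 _·_
  _·_ : ∀ {m n o} → Matrix m n → Matrix n o → Matrix m o
  (X · Y) i j = ∑ λ k → X i k * Y k j

  -1#*x≈-x : ∀ x → (- 1#) * x ≈ - x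
  -1#*x≈-x x = trans (sym (-‿distribˡ-* 1# x)) (-‿cong (*-identityˡ x))

  sgn-suc : ∀ {n} (k : Fin n) x → sgn (suc k) * x ≈ - (sgn k * x)
  sgn-suc k x = trans (*-assoc _ _ x) (-1#*x≈-x _)

  PairWeight : ℕ → Set c
  PairWeight n = Fin (suc n) → Fin n → Carrier

  -- The sum of sgn k · sgn l · u k · v k′ · w k l over ordered pairs of
  -- distinct indices k, k′ = punchIn k l.
  pairSum : ∀ {n} → PairWeight n → (u v : Vector Carrier (suc n)) → Carrier
  pairSum w u v = ∑ λ k → sgn k * (u k * ∑ λ l → sgn l * (v (punchIn k l) * w k l))

  -- The two equations say that `(k , l)` and `(k′ , l′)` encode the same two columns in opposite
  -- orders, so the weight depends only on the unordered pair.
  PairSymmetric : ∀ {n} → PairWeight n → Set ℓ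
  PairSymmetric w = ∀ k l k′ l′ → punchIn k l ≡ k′ → punchIn k′ l′ ≡ k → w k l ≈ w k′ l′

  tail₂ : ∀ {n} → PairWeight (suc n) → PairWeight n
  tail₂ w k l = w (suc k) (suc l)

  tail₂-symmetric : ∀ {n} {w : PairWeight (suc n)} → PairSymmetric w → PairSymmetric (tail₂ w)
  tail₂-symmetric sym-w k l k′ l′ eq eq′ =
    sym-w (suc k) (suc l) (suc k′) (suc l′) (≡.cong suc eq) (≡.cong suc eq′)

  row₀ : ∀ {n} → PairWeight (suc n) → Vector Carrier (suc (suc n)) → Carrier
  row₀ w v = ∑ λ l → sgn l * (v (suc l) * w zero l)

  -- Splits off the pairs that contain index 0. If 0 comes first the sign is that of `l`; if it
  -- comes second, the shift from `k` to `suc k` costs a factor -1, hence the difference. In pairs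
  -- without 0 the two shifts cancel.
  pairSum-suc : ∀ {n} {w : PairWeight (suc n)} → PairSymmetric w → ∀ u v →
                pairSum w u v ≈
                  (u zero * row₀ w v - v zero * row₀ w u) + pairSum (tail₂ w) (tail u) (tail v)
  pairSum-suc {n} {w} sym-w u v = begin
    pairSum w u v
      ≈⟨ ∑-suc _ ⟩
    1# * (u zero * row₀ w v) + ∑ (λ k → sgn (suc k) * (u (suc k) * C k))
      ≈⟨ +-cong (*-identityˡ _) (∑-cong term) ⟩
    u zero * row₀ w v + ∑ (λ k → - (v zero * D k) + E k)
      ≈⟨ +-congˡ (∑-+ _ _) ⟩
    u zero * row₀ w v + (∑ (λ k → - (v zero * D k)) + ∑ E)
      ≈⟨ +-congˡ (+-congʳ (trans (-‿∑ _) (-‿cong (*-∑ _ _)))) ⟩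
    u zero * row₀ w v + (- (v zero * row₀ w u) + ∑ E)
      ≈⟨ +-assoc _ _ _ ⟨
    (u zero * row₀ w v - v zero * row₀ w u) + ∑ E
      ∎
    where
    A B C D E : Fin (suc n) → Carrier
    A k = v zero * w (suc k) zero
    B k = ∑ λ l → sgn l * (v (suc (punchIn k l)) * w (suc k) (suc l))
    C k = ∑ λ l → sgn l * (v (punchIn (suc k) l) * w (suc k) l)
    D l = sgn l * (u (suc l) * w zero l)
    E k = sgn k * (u (suc k) * B k)

    C≈A-B : ∀ k → C k ≈ A k + - B k
    C≈A-B k = trans (∑-suc _)
      (+-cong (*-identityˡ _) (trans (∑-cong λ l → sgn-suc l _) (-‿∑ _)))

    A≈D : ∀ k → sgn k * (u (suc k) * A k) ≈ v zero * D k
    A≈D k = begin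
      sgn k * (u (suc k) * (v zero * w (suc k) zero))
        ≈⟨ *-congˡ (x∙yz≈y∙xz _ _ _) ⟩
      sgn k * (v zero * (u (suc k) * w (suc k) zero))
        ≈⟨ x∙yz≈y∙xz _ _ _ ⟩
      v zero * (sgn k * (u (suc k) * w (suc k) zero))
        ≈⟨ *-congˡ (*-congˡ (*-congˡ (sym-w zero k (suc k) zero ≡.refl ≡.refl))) ⟨
      v zero * D k
        ∎

    term : ∀ k → sgn (suc k) * (u (suc k) * C k) ≈ - (v zero * D k) + E k
    term k = begin
      sgn (suc k) * (u (suc k) * C k)
        ≈⟨ sgn-suc k _ ⟩
      - (sgn k * (u (suc k) * C k))
        ≈⟨ -‿cong (*-congˡ (trans (*-congˡ (C≈A-B k)) (distribˡ _ _ _))) ⟩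
      - (sgn k * (u (suc k) * A k + u (suc k) * - B k))
        ≈⟨ -‿cong (distribˡ _ _ _) ⟩
      - (sgn k * (u (suc k) * A k) + sgn k * (u (suc k) * - B k))
        ≈⟨ -‿cong (+-cong (A≈D k) (trans (*-congˡ (sym (-‿distribʳ-* _ _))) (sym (-‿distribʳ-* _ _)))) ⟩
      - (v zero * D k + - E k)
        ≈⟨ -‿+-comm _ _ ⟨
      - (v zero * D k) + - (- E k)
        ≈⟨ +-congˡ (-‿involutive _) ⟩
      - (v zero * D k) + E k
        ∎

  pairSum-zero : ∀ (w : PairWeight 0) u v → pairSum w u v ≈ 0#
  pairSum-zero w u v = ∑-0 λ k → trans (*-congˡ (trans (*-congˡ (∑-zero _)) (zeroʳ _))) (zeroʳ _)

  cancel-cross : ∀ x y → (x - y) + (y - x) ≈ 0#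
  cancel-cross x y = begin
    (x - y) + (y - x)      ≈⟨ +-congˡ (+-comm _ _) ⟩
    (x - y) + (- x + y)    ≈⟨ +-interchange _ _ _ _ ⟩
    (x - x) + (- y + y)    ≈⟨ +-cong (-‿inverseʳ x) (-‿inverseˡ y) ⟩
    0# + 0#                ≈⟨ +-identityˡ 0# ⟩
    0#                     ∎

  pairSum-antisym : ∀ {n} {w : PairWeight n} → PairSymmetric w → ∀ u v →
                    pairSum w u v + pairSum w v u ≈ 0#
  pairSum-antisym {zero} sym-w u v =
    trans (+-cong (pairSum-zero _ u v) (pairSum-zero _ v u)) (+-identityˡ 0#)
  pairSum-antisym {suc n} sym-w u v = begin
    _          ≈⟨ +-cong (pairSum-suc sym-w u v) (pairSum-suc sym-w v u) ⟩
    _          ≈⟨ +-interchange _ _ _ _ ⟩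
    _          ≈⟨ +-cong (cancel-cross _ _) (pairSum-antisym (tail₂-symmetric sym-w) (tail u) (tail v)) ⟩
    0# + 0#    ≈⟨ +-identityˡ 0# ⟩
    0#         ∎

  -- Antisymmetry would only show that twice the sum vanishes, which is too weak over an arbitrary
  -- commutative ring; the recursion gives the vanishing itself.
  pairSum-alternating : ∀ {n} {w : PairWeight n} → PairSymmetric w → ∀ u → pairSum w u u ≈ 0#
  pairSum-alternating {zero} sym-w u = pairSum-zero _ u u
  pairSum-alternating {suc n} sym-w u = begin
    _          ≈⟨ pairSum-suc sym-w u u ⟩
    _          ≈⟨ +-cong (-‿inverseʳ _) (pairSum-alternating (tail₂-symmetric sym-w) (tail u)) ⟩
    0# + 0#    ≈⟨ +-identityˡ 0# ⟩
    0#         ∎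

  minors : ∀ {n} → Matrix n (suc (suc n)) → PairWeight (suc n)
  minors Z k l = ∥ dropColumn l (dropColumn k Z) ∥

  minors-symmetric : ∀ {n} (Z : Matrix n (suc (suc n))) → PairSymmetric (minors Z)
  minors-symmetric Z k l k′ l′ eq eq′ = det-cong λ i j →
    reflexive (≡.cong (Z i) (punchIn-swap k l k′ l′ j eq eq′))

  det-∷∷ : ∀ {n} u v (Z : Matrix n (suc (suc n))) → ∥ u ∷ v ∷ Z ∥ ≈ pairSum (minors Z) u v
  det-∷∷ u v Z = trans (laplace-∷ u (v ∷ Z)) (∑-cong λ k → *-congˡ (*-congˡ (laplace _)))

  det-swap : ∀ {n} u v (Z : Matrix n (suc (suc n))) → ∥ u ∷ v ∷ Z ∥ ≈ - ∥ v ∷ u ∷ Z ∥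
  det-swap u v Z = +-inverseˡ-unique _ _
    (trans (+-cong (det-∷∷ u v Z) (det-∷∷ v u Z)) (pairSum-antisym (minors-symmetric Z) u v))

  det-repeated : ∀ {n} v (Z : Matrix n (suc (suc n))) → ∥ v ∷ v ∷ Z ∥ ≈ 0#
  det-repeated v Z = trans (det-∷∷ v v Z) (pairSum-alternating (minors-symmetric Z) v)

  det-+ : ∀ {n} u v (Z : Matrix n (suc n)) →
          ∥ (λ j → u j + v j) ∷ Z ∥ ≈ ∥ u ∷ Z ∥ + ∥ v ∷ Z ∥
  det-+ u v Z = begin
    ∥ (λ j → u j + v j) ∷ Z ∥
      ≈⟨ laplace-∷ _ Z ⟩
    ∑ (λ k → sgn k * ((u k + v k) * ∥ dropColumn k Z ∥))
      ≈⟨ ∑-cong (λ k → trans (*-congˡ (distribʳ _ _ _)) (distribˡ _ _ _)) ⟩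
    ∑ (λ k → sgn k * (u k * ∥ dropColumn k Z ∥) + sgn k * (v k * ∥ dropColumn k Z ∥))
      ≈⟨ ∑-+ _ _ ⟩
    ∑ (λ k → sgn k * (u k * ∥ dropColumn k Z ∥)) + ∑ (λ k → sgn k * (v k * ∥ dropColumn k Z ∥))
      ≈⟨ +-cong (laplace-∷ u Z) (laplace-∷ v Z) ⟨
    ∥ u ∷ Z ∥ + ∥ v ∷ Z ∥
      ∎

  det-* : ∀ {n} a v (Z : Matrix n (suc n)) → ∥ (λ j → a * v j) ∷ Z ∥ ≈ a * ∥ v ∷ Z ∥
  det-* a v Z = begin
    ∥ (λ j → a * v j) ∷ Z ∥
      ≈⟨ laplace-∷ _ Z ⟩
    ∑ (λ k → sgn k * (a * v k * ∥ dropColumn k Z ∥))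
      ≈⟨ ∑-cong (λ k → trans (*-congˡ (*-assoc _ _ _)) (x∙yz≈y∙xz _ _ _)) ⟩
    ∑ (λ k → a * (sgn k * (v k * ∥ dropColumn k Z ∥)))
      ≈⟨ *-∑ a _ ⟩
    a * ∑ (λ k → sgn k * (v k * ∥ dropColumn k Z ∥))
      ≈⟨ *-congˡ (laplace-∷ v Z) ⟨
    a * ∥ v ∷ Z ∥
      ∎

  det-∷-cong : ∀ {n} {u v} (Z : Matrix n (suc n)) → (∀ j → u j ≈ v j) → ∥ u ∷ Z ∥ ≈ ∥ v ∷ Z ∥
  det-∷-cong Z u≈v = det-cong λ { zero j → u≈v j ; (suc i) j → refl }

  det-∑ : ∀ {n m} (a : Vector Carrier m) (V : Matrix m (suc n)) (Z : Matrix n (suc n)) →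
          ∥ (λ j → ∑ λ k → a k * V k j) ∷ Z ∥ ≈ ∑ λ k → a k * ∥ V k ∷ Z ∥
  det-∑ {m = zero} a V Z = begin
    ∥ (λ j → ∑ λ k → a k * V k j) ∷ Z ∥
      ≈⟨ laplace-∷ _ Z ⟩
    ∑ (λ l → sgn l * (∑ (λ k → a k * V k l) * ∥ dropColumn l Z ∥))
      ≈⟨ ∑-0 (λ l → trans (*-congˡ (trans (*-congʳ (∑-zero _)) (zeroˡ _))) (zeroʳ _)) ⟩
    0#
      ≈⟨ ∑-zero _ ⟨
    ∑ (λ k → a k * ∥ V k ∷ Z ∥)
      ∎
  det-∑ {m = suc m} a V Z = begin
    ∥ (λ j → ∑ λ k → a k * V k j) ∷ Z ∥
      ≈⟨ det-∷-cong Z (λ j → ∑-suc _) ⟩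
    ∥ (λ j → a zero * V zero j + ∑ λ k → a (suc k) * V (suc k) j) ∷ Z ∥
      ≈⟨ det-+ _ _ Z ⟩
    ∥ (λ j → a zero * V zero j) ∷ Z ∥ + ∥ (λ j → ∑ λ k → a (suc k) * V (suc k) j) ∷ Z ∥
      ≈⟨ +-cong (det-* _ _ Z) (det-∑ (tail a) (tail V) Z) ⟩
    a zero * ∥ V zero ∷ Z ∥ + ∑ (λ k → a (suc k) * ∥ V (suc k) ∷ Z ∥)
      ≈⟨ ∑-suc _ ⟨
    ∑ (λ k → a k * ∥ V k ∷ Z ∥)
      ∎

  -- The expansion runs along the first row only, so the second row is swapped to the top. There its
  -- multiple of `v` drops out by linearity and `det-repeated`, and in the minors `v` is the first
  -- row again, so induction treats the other rows.
  det-+*row : ∀ {n} (v : Vector Carrier (suc n)) (Z : Matrix n (suc n)) (a : Vector Carrier n) →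
              ∥ v ∷ (λ i j → Z i j + a i * v j) ∥ ≈ ∥ v ∷ Z ∥
  det-+*row {zero}  v Z a = det-cong λ { zero j → refl }
  det-+*row {suc n} v Z a = begin
    ∥ v ∷ (λ i j → Z i j + a i * v j) ∥
      ≈⟨ det-cong (λ { zero j → refl ; (suc zero) j → refl ; (suc (suc i)) j → refl }) ⟩
    ∥ v ∷ (λ j → z j + a zero * v j) ∷ Z′ ∥
      ≈⟨ det-swap _ _ Z′ ⟩
    - ∥ (λ j → z j + a zero * v j) ∷ v ∷ Z′ ∥
      ≈⟨ -‿cong (trans (det-+ _ _ _) (+-congˡ (det-* _ _ _))) ⟩
    - (∥ z ∷ v ∷ Z′ ∥ + a zero * ∥ v ∷ v ∷ Z′ ∥)
      ≈⟨ -‿cong (trans (+-congˡ (trans (*-congˡ (det-repeated v Z′)) (zeroʳ _))) (+-identityʳ _)) ⟩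
    - ∥ z ∷ v ∷ Z′ ∥
      ≈⟨ -‿cong (laplace-∷ z _) ⟩
    - ∑ (λ k → sgn k * (z k * ∥ dropColumn k (v ∷ Z′) ∥))
      ≈⟨ -‿cong (∑-cong λ k → *-congˡ (*-congˡ (minor k))) ⟩
    - ∑ (λ k → sgn k * (z k * ∥ dropColumn k (v ∷ tail Z) ∥))
      ≈⟨ -‿cong (laplace-∷ z _) ⟨
    - ∥ z ∷ v ∷ tail Z ∥
      ≈⟨ det-swap _ _ (tail Z) ⟨
    ∥ v ∷ z ∷ tail Z ∥
      ≈⟨ det-cong (λ { zero j → refl ; (suc zero) j → refl ; (suc (suc i)) j → refl }) ⟩
    ∥ v ∷ Z ∥
      ∎
    where
    z = Z zero
    Z′ : Matrix n (suc (suc n))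
    Z′ i j = Z (suc i) j + a (suc i) * v j
    minor : ∀ k → ∥ dropColumn k (v ∷ Z′) ∥ ≈ ∥ dropColumn k (v ∷ tail Z) ∥
    minor k = begin
      ∥ dropColumn k (v ∷ Z′) ∥
        ≈⟨ det-∷ _ ⟩
      ∥ removeAt v k ∷ dropColumn k Z′ ∥
        ≈⟨ det-+*row (removeAt v k) (dropColumn k (tail Z)) (tail a) ⟩
      ∥ removeAt v k ∷ dropColumn k (tail Z) ∥
        ≈⟨ det-∷ _ ⟨
      ∥ dropColumn k (v ∷ tail Z) ∥
        ∎

  -- A cycle of `k` adjacent swaps. One swap brings row zero to the top; expanding along it leaves
  -- minors in which the chosen row still leads and has one place fewer to travel.
  det-moveToFront : ∀ {n} (k : Fin (suc n)) (Y : Matrix (suc n) (suc n)) →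
                    ∥ Y k ∷ removeAt Y k ∥ ≈ sgn k * ∥ Y ∥
  det-moveToFront zero Y = trans (sym (det-∷ Y)) (sym (*-identityˡ _))
  det-moveToFront {suc n} (suc k) Y = begin
    ∥ Y (suc k) ∷ removeAt Y (suc k) ∥
      ≈⟨ det-cong (λ { zero j → refl ; (suc zero) j → refl ; (suc (suc i)) j → refl }) ⟩
    ∥ Y (suc k) ∷ Y zero ∷ removeAt (tail Y) k ∥
      ≈⟨ det-swap _ _ _ ⟩
    - ∥ Y zero ∷ Y (suc k) ∷ removeAt (tail Y) k ∥
      ≈⟨ -‿cong (trans (laplace-∷ _ _) (∑-cong term)) ⟩
    - ∑ (λ l → sgn k * (sgn l * (Y zero l * ∥ dropColumn l (tail Y) ∥)))
      ≈⟨ -‿cong (*-∑ (sgn k) _) ⟩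
    - (sgn k * ∑ (λ l → sgn l * (Y zero l * ∥ dropColumn l (tail Y) ∥)))
      ≈⟨ -‿cong (*-congˡ (laplace Y)) ⟨
    - (sgn k * ∥ Y ∥)
      ≈⟨ sgn-suc k _ ⟨
    sgn (suc k) * ∥ Y ∥
      ∎
    where
    term : ∀ l → sgn l * (Y zero l * ∥ dropColumn l (Y (suc k) ∷ removeAt (tail Y) k) ∥)
               ≈ sgn k * (sgn l * (Y zero l * ∥ dropColumn l (tail Y) ∥))
    term l = begin
      _ ≈⟨ *-congˡ (*-congˡ (trans (det-∷ _) (det-moveToFront k (dropColumn l (tail Y))))) ⟩
      _ ≈⟨ *-congˡ (x∙yz≈y∙xz _ _ _) ⟩
      _ ≈⟨ x∙yz≈y∙xz _ _ _ ⟩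
      _ ∎

  -- The first row of `X · Y` is a combination of the rows `Y k`. With `Y k` on top, its multiples
  -- are cleared from the lower rows, which leaves a product of smaller matrices; induction and
  -- moving `Y k` back into place give sgn k times a minor of `X` times the determinant of `Y`. The
  -- sum over `k` is then the expansion of `X`.
  det-· : ∀ {n} (X Y : Matrix n n) → ∥ X · Y ∥ ≈ ∥ X ∥ * ∥ Y ∥
  det-· {zero}  X Y = trans (det-zero _)
    (sym (trans (*-cong (det-zero X) (det-zero Y)) (*-identityˡ 1#)))
  det-· {suc n} X Y = begin
    ∥ X · Y ∥
      ≈⟨ det-∷ (X · Y) ⟩
    ∥ (X · Y) zero ∷ tail X · Y ∥
      ≈⟨ det-∑ (X zero) Y (tail X · Y) ⟩
    ∑ (λ k → X zero k * ∥ Y k ∷ tail X · Y ∥)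
      ≈⟨ ∑-cong (λ k → trans
           (*-congˡ (trans (reduce k) (trans (expand k) (*-congˡ (det-moveToFront k Y)))))
           (regroup _ _ _ _)) ⟩
    ∑ (λ k → sgn k * (X zero k * ∥ X′ k ∥) * ∥ Y ∥)
      ≈⟨ ∑-* ∥ Y ∥ _ ⟩
    ∑ (λ k → sgn k * (X zero k * ∥ X′ k ∥)) * ∥ Y ∥
      ≈⟨ *-congʳ (laplace X) ⟨
    ∥ X ∥ * ∥ Y ∥
      ∎
    where
    X′ : Fin (suc n) → Matrix n n
    X′ k = dropColumn k (tail X)

    reduce : ∀ k → ∥ Y k ∷ tail X · Y ∥ ≈ ∥ Y k ∷ X′ k · removeAt Y k ∥
    reduce k = trans
      (det-cong λ { zero j → refl ; (suc i) j → ∑-remove k _ })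
      (det-+*row (Y k) (X′ k · removeAt Y k) (λ i → X (suc i) k))

    expand : ∀ k → ∥ Y k ∷ X′ k · removeAt Y k ∥ ≈ ∥ X′ k ∥ * ∥ Y k ∷ removeAt Y k ∥
    expand k = begin
      ∥ Y k ∷ X′ k · removeAt Y k ∥
        ≈⟨ laplace-∷ _ _ ⟩
      ∑ (λ l → sgn l * (Y k l * ∥ X′ k · dropColumn l (removeAt Y k) ∥))
        -- Deleting a column of a product deletes it in the right factor, so the induction applies
        -- to each minor.
        ≈⟨ ∑-cong (λ l → *-congˡ (*-congˡ (det-· (X′ k) (dropColumn l (removeAt Y k))))) ⟩
      ∑ (λ l → sgn l * (Y k l * (∥ X′ k ∥ * ∥ dropColumn l (removeAt Y k) ∥)))
        ≈⟨ ∑-cong (λ l → trans (*-congˡ (x∙yz≈y∙xz _ _ _)) (x∙yz≈y∙xz _ _ _)) ⟩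
      ∑ (λ l → ∥ X′ k ∥ * (sgn l * (Y k l * ∥ dropColumn l (removeAt Y k) ∥)))
        ≈⟨ *-∑ ∥ X′ k ∥ _ ⟩
      ∥ X′ k ∥ * ∑ (λ l → sgn l * (Y k l * ∥ dropColumn l (removeAt Y k) ∥))
        ≈⟨ *-congˡ (laplace-∷ _ _) ⟨
      ∥ X′ k ∥ * ∥ Y k ∷ removeAt Y k ∥
        ∎

    regroup : ∀ x y s z → x * (y * (s * z)) ≈ s * (x * y) * z
    regroup x y s z = begin
      x * (y * (s * z)) ≈⟨ *-assoc x y _ ⟨
      x * y * (s * z)   ≈⟨ x∙yz≈y∙xz _ _ _ ⟩
      s * (x * y * z)   ≈⟨ *-assoc s _ z ⟨
      s * (x * y) * z   ∎

  det-scaleRows : ∀ {n} (a : Vector Carrier n) (M : Matrix n n) →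
                  ∥ (λ i j → a i * M i j) ∥ ≈ product a * ∥ M ∥
  det-scaleRows {zero}  a M = trans (det-zero _) (sym (trans (*-identityˡ _) (det-zero M)))
  det-scaleRows {suc n} a M = begin
    ∥ (λ i j → a i * M i j) ∥
      ≈⟨ laplace _ ⟩
    ∑ (λ k → sgn k * (a zero * M zero k * ∥ (λ i j → a (suc i) * M′ k i j) ∥))
      ≈⟨ ∑-cong (λ k → *-congˡ (*-congˡ (det-scaleRows (tail a) (M′ k)))) ⟩
    ∑ (λ k → sgn k * (a zero * M zero k * (product (tail a) * ∥ M′ k ∥)))
      ≈⟨ ∑-cong (λ k → trans (*-congˡ (interchange _ _ _ _)) (x∙yz≈y∙xz _ _ _)) ⟩
    ∑ (λ k → product a * (sgn k * (M zero k * ∥ M′ k ∥)))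
      ≈⟨ *-∑ (product a) _ ⟩
    product a * ∑ (λ k → sgn k * (M zero k * ∥ M′ k ∥))
      ≈⟨ *-congˡ (laplace M) ⟨
    product a * ∥ M ∥
      ∎
    where
    M′ : Fin (suc n) → Matrix n n
    M′ k = dropColumn k (tail M)

  det-diagonal : ∀ {n} (M : Matrix n n) → (∀ i j → i ≢ j → M i j ≈ 0#) → ∥ M ∥ ≈ product λ i → M i i
  det-diagonal {zero}  M off = det-zero M
  det-diagonal {suc n} M off = begin
    ∥ M ∥
      ≈⟨ trans (laplace M) (∑-suc _) ⟩
    1# * (M zero zero * ∥ M₀ ∥) + ∑ (λ k → sgn (suc k) * (M zero (suc k) * ∥ dropColumn (suc k) (tail M) ∥))
      ≈⟨ +-cong (*-identityˡ _) (∑-0 λ k → trans (*-congˡ (trans (*-congʳ (off zero (suc k) λ ())) (zeroˡ _))) (zeroʳ _)) ⟩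
    M zero zero * ∥ M₀ ∥ + 0#
      ≈⟨ +-identityʳ _ ⟩
    M zero zero * ∥ M₀ ∥
      ≈⟨ *-congˡ (det-diagonal M₀ λ i j i≢j → off (suc i) (suc j) (i≢j ∘ Fin.suc-injective)) ⟩
    product (λ i → M i i)
      ∎
    where
    M₀ = dropColumn zero (tail M)

open import Data.Integer.Base as ℤ using (ℤ; +_; -_; _-_; _+_; _*_; _^_; 0ℤ; 1ℤ; -1ℤ)
open import Data.Integer.DivMod using (_%ℕ_; _/ℕ_; a≡a%ℕn+[a/ℕn]*n)
open import Data.Integer.Divisibility.Signed using (_∣_; divides; _∣?_; ∣ᵤ⇒∣; ∣⇒∣ᵤ; ∣m∣n⇒∣m+n; ∣n⇒∣m*n)
import Data.Integer.Properties as ℤ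
open import Data.Integer.Solver using (module +-*-Solver)
open import Data.Rational.Base as ℚ using (ℚ; mkℚ; _/_; toℚᵘ; 1ℚ)
import Data.Rational.Properties as ℚ
import Data.Rational.Solver as ℚ
open import Data.Rational.Unnormalised.Base as ℚᵘ using (mkℚᵘ; *≡*)
import Data.Rational.Unnormalised.Properties as ℚᵘ
open import Data.Vec.Base using (Vec; []; _∷_; replicate)
open import Relation.Binary.PropositionalEquality using (refl; sym; trans; cong; cong₂; module ≡-Reasoning)
open import Algebra.Properties.CommutativeSemigroup ℤ.*-commutativeSemigroup using (interchange)
open +-*-Solver using (solve; _:=_; con; _:+_; _:*_; _:-_; :-_)

-- Products and homogeneous sums of integers

^-distribʳ-* : ∀ i j n → (i * j) ^ n ≡ i ^ n * j ^ n
^-distribʳ-* i j zero    = refl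
^-distribʳ-* i j (suc n) = trans (cong (i * j *_) (^-distribʳ-* i j n)) (interchange i j (i ^ n) (j ^ n))

^-swap : ∀ i m n → (i ^ m) ^ n ≡ (i ^ n) ^ m
^-swap i m n = trans (ℤ.^-*-assoc i m n) (trans (cong (i ^_) (ℕ.*-comm m n)) (sym (ℤ.^-*-assoc i n m)))

^-double : ∀ i n → i ^ (n ℕ.+ n) ≡ (i * i) ^ n
^-double i n = trans (ℤ.^-distribˡ-+-* i n n) (sym (^-distribʳ-* i i n))

∏ : ℕ → (ℕ → ℤ) → ℤ
∏ zero    f = 1ℤ
∏ (suc n) f = f 0 * ∏ n (f ∘ suc)

∏-cong : ∀ n {f g : ℕ → ℤ} → (∀ {i} → i < n → f i ≡ g i) → ∏ n f ≡ ∏ n g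
∏-cong zero    f≡g = refl
∏-cong (suc n) f≡g = cong₂ _*_ (f≡g z<s) (∏-cong n (f≡g ∘ s<s))

∏-* : ∀ n f g → ∏ n (λ i → f i * g i) ≡ ∏ n f * ∏ n g
∏-* zero    f g = refl
∏-* (suc n) f g = trans (cong (f 0 * g 0 *_) (∏-* n (f ∘ suc) (g ∘ suc))) (interchange (f 0) (g 0) (∏ n (f ∘ suc)) (∏ n (g ∘ suc)))

∏-const : ∀ n c → ∏ n (λ _ → c) ≡ c ^ n
∏-const zero    c = refl
∏-const (suc n) c = cong (c *_) (∏-const n c)

∏-^ : ∀ n f k → ∏ n (λ i → f i ^ k) ≡ ∏ n f ^ k
∏-^ n f zero    = trans (∏-const n 1ℤ) (ℤ.^-zeroˡ n)
∏-^ n f (suc k) = trans (∏-* n f (λ i → f i ^ k)) (cong (∏ n f *_) (∏-^ n f k))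

∏-snoc : ∀ n f → ∏ (suc n) f ≡ ∏ n f * f n
∏-snoc zero    f = ℤ.*-comm (f 0) 1ℤ
∏-snoc (suc n) f = trans (cong (f 0 *_) (∏-snoc n (f ∘ suc))) (sym (ℤ.*-assoc (f 0) (∏ n (f ∘ suc)) (f (suc n))))

∏-split : ∀ m n f → ∏ (m ℕ.+ n) f ≡ ∏ m f * ∏ n (f ∘ (m ℕ.+_))
∏-split zero    n f = sym (ℤ.*-identityˡ (∏ n f))
∏-split (suc m) n f = trans (cong (f 0 *_) (∏-split m n (f ∘ suc))) (sym (ℤ.*-assoc (f 0) (∏ m (f ∘ suc)) (∏ n (f ∘ (suc m ℕ.+_)))))

∏-reverse : ∀ n f → ∏ n f ≡ ∏ n (λ i → f (n ∸ suc i))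
∏-reverse zero    f = refl
∏-reverse (suc n) f = begin
  ∏ (suc n) f                          ≡⟨ ∏-snoc n f ⟩
  ∏ n f * f n                          ≡⟨ ℤ.*-comm (∏ n f) (f n) ⟩
  f n * ∏ n f                          ≡⟨ cong (f n *_) (∏-reverse n f) ⟩
  f n * ∏ n (λ i → f (n ∸ suc i))      ∎
  where open ≡-Reasoning

∏-zero : ∀ n f {k} → k < n → f k ≡ 0ℤ → ∏ n f ≡ 0ℤ
∏-zero (suc n) f {zero}  _         f0≡0 = trans (cong (_* ∏ n (f ∘ suc)) f0≡0) refl
∏-zero (suc n) f {suc k} (s<s k<n) fk≡0 = trans (cong (f 0 *_) (∏-zero n (f ∘ suc) k<n fk≡0)) (ℤ.*-zeroʳ (f 0))

-- The exponents add up to 0 + ⋯ + (2m - 1) = 2m·m - m. The factor e^m avoids the subtraction and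
-- leaves a power of e^(2m), the quantity known modulo `p`. For 2m + 1 factors the sum is (2m + 1)m
-- and nothing has to be compensated.
∏-powers-even : ∀ e m → ∏ (m ℕ.+ m) (e ^_) * e ^ m ≡ (e ^ (m ℕ.+ m)) ^ m
∏-powers-even e zero    = refl
∏-powers-even e (suc m) = begin
  ∏ (suc m ℕ.+ suc m) (e ^_) * e ^ suc m
    ≡⟨ cong (λ k → ∏ k (e ^_) * e ^ suc m) (cong suc (ℕ.+-suc m m)) ⟩
  ∏ (suc (suc 2m)) (e ^_) * e ^ suc m
    ≡⟨ cong (_* e ^ suc m) (trans (∏-snoc (suc 2m) (e ^_)) (cong (_* e ^ suc 2m) (∏-snoc 2m (e ^_)))) ⟩
  ∏ 2m (e ^_) * e ^ 2m * e ^ suc 2m * (e * e ^ m)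
    ≡⟨ solve 5 (λ P x y e z → P :* x :* y :* (e :* z) := (P :* z) :* (x :* (y :* e))) refl
         (∏ 2m (e ^_)) (e ^ 2m) (e ^ suc 2m) e (e ^ m) ⟩
  ∏ 2m (e ^_) * e ^ m * (e ^ 2m * (e ^ suc 2m * e))
    ≡⟨ cong₂ _*_ (trans (∏-powers-even e m) (ℤ.^-*-assoc e 2m m))
         (cong (λ x → e ^ 2m * (e ^ suc 2m * x)) (sym (ℤ.^-identityʳ e))) ⟩
  e ^ (2m ℕ.* m) * (e ^ 2m * (e ^ suc 2m * e ^ 1))
    ≡⟨ trans (cong (λ x → e ^ (2m ℕ.* m) * (e ^ 2m * x)) (sym (ℤ.^-distribˡ-+-* e (suc 2m) 1)))
         (trans (cong (e ^ (2m ℕ.* m) *_) (sym (ℤ.^-distribˡ-+-* e 2m (suc 2m ℕ.+ 1))))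
           (sym (ℤ.^-distribˡ-+-* e (2m ℕ.* m) (2m ℕ.+ (suc 2m ℕ.+ 1))))) ⟩
  e ^ (2m ℕ.* m ℕ.+ (2m ℕ.+ (suc 2m ℕ.+ 1)))
    ≡⟨ cong (e ^_) (S.solve 1 (λ m → (m S.:+ m) S.:* m S.:+ ((m S.:+ m) S.:+ ((S.con 1 S.:+ (m S.:+ m)) S.:+ S.con 1))
                              S.:= ((S.con 1 S.:+ m) S.:+ (S.con 1 S.:+ m)) S.:* (S.con 1 S.:+ m)) refl m) ⟩
  e ^ ((suc m ℕ.+ suc m) ℕ.* suc m)
    ≡⟨ ℤ.^-*-assoc e (suc m ℕ.+ suc m) (suc m) ⟨
  (e ^ (suc m ℕ.+ suc m)) ^ suc m
    ∎
  where
  open ≡-Reasoning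
  module S = ℕ.+-*-Solver
  2m = m ℕ.+ m

∏-powers-odd : ∀ e m → ∏ (suc (m ℕ.+ m)) (e ^_) ≡ (e ^ suc (m ℕ.+ m)) ^ m
∏-powers-odd e m = begin
  ∏ (suc (m ℕ.+ m)) (e ^_)                     ≡⟨ ∏-snoc (m ℕ.+ m) (e ^_) ⟩
  ∏ (m ℕ.+ m) (e ^_) * e ^ (m ℕ.+ m)           ≡⟨ cong (∏ (m ℕ.+ m) (e ^_) *_) (ℤ.^-distribˡ-+-* e m m) ⟩
  ∏ (m ℕ.+ m) (e ^_) * (e ^ m * e ^ m)         ≡⟨ ℤ.*-assoc (∏ (m ℕ.+ m) (e ^_)) (e ^ m) (e ^ m) ⟨
  ∏ (m ℕ.+ m) (e ^_) * e ^ m * e ^ m           ≡⟨ cong (_* e ^ m) (∏-powers-even e m) ⟩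
  (e ^ (m ℕ.+ m)) ^ m * e ^ m                  ≡⟨ ℤ.*-comm ((e ^ (m ℕ.+ m)) ^ m) (e ^ m) ⟩
  e ^ m * (e ^ (m ℕ.+ m)) ^ m                  ≡⟨ ^-distribʳ-* e (e ^ (m ℕ.+ m)) m ⟨
  (e ^ suc (m ℕ.+ m)) ^ m                      ∎
  where open ≡-Reasoning

positive even odd : ℕ → ℤ
positive i = + suc i
even i     = + suc i + + suc i
odd i      = + suc (i ℕ.+ i)

factorial evenProduct oddProduct : ℕ → ℤ
factorial n   = ∏ n positive
evenProduct n = ∏ n even
oddProduct n  = ∏ n odd

factorial-odd : ∀ m → factorial (suc (m ℕ.+ m)) ≡ evenProduct m * oddProduct (suc m)
factorial-odd zero    = refl
factorial-odd (suc m) = begin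
  factorial (suc (suc m ℕ.+ suc m))
    ≡⟨ cong factorial (cong suc (cong suc (ℕ.+-suc m m))) ⟩
  factorial (suc (suc (suc 2m)))
    ≡⟨ trans (∏-snoc (suc (suc 2m)) positive) (cong (_* + suc (suc (suc 2m))) (∏-snoc (suc 2m) positive)) ⟩
  factorial (suc 2m) * + suc (suc 2m) * + suc (suc (suc 2m))
    ≡⟨ cong (λ x → x * + suc (suc 2m) * + suc (suc (suc 2m))) (factorial-odd m) ⟩
  evenProduct m * oddProduct (suc m) * + suc (suc 2m) * + suc (suc (suc 2m))
    ≡⟨ solve 3 (λ E O x → E :* O :* (con (+ 2) :+ (x :+ x)) :* (con (+ 3) :+ (x :+ x))
               := (E :* ((con 1ℤ :+ x) :+ (con 1ℤ :+ x))) :* (O :* (con (+ 1) :+ ((con 1ℤ :+ x) :+ (con 1ℤ :+ x))))) refl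
         (evenProduct m) (oddProduct (suc m)) (+ m) ⟩
  (evenProduct m * (+ suc m + + suc m)) * (oddProduct (suc m) * + suc (suc m ℕ.+ suc m))
    ≡⟨ cong₂ _*_ (∏-snoc m even) (∏-snoc (suc m) odd) ⟨
  evenProduct (suc m) * oddProduct (suc (suc m))
    ∎
  where
  open ≡-Reasoning
  2m = m ℕ.+ m

-- For n = 2m + 1 the factors 2 - n + 2i run over the odd numbers from
-- -(2m - 1) to 2m + 1.
∏-odd-range : ∀ m → let n = suc (m ℕ.+ m) in
              ∏ n (λ i → (+ 2 - + n) + (+ i + + i)) ≡ -1ℤ ^ m * (oddProduct m * oddProduct m) * + n
∏-odd-range zero    = refl
∏-odd-range (suc m) = begin
  ∏ n′ (weight n′)
    ≡⟨ cong (λ k → ∏ k (weight k)) (cong 2+ (ℕ.+-suc m m)) ⟩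
  ∏ (suc (suc n)) (weight (suc (suc n)))
    -- Raising n by 2 keeps the old factors, shifted by one index, and adds -n at the bottom and n +
    -- 2 at the top.
    ≡⟨ cong (weight (suc (suc n)) 0 *_) (trans (∏-snoc n (weight (suc (suc n)) ∘ suc)) (cong (_* weight (suc (suc n)) (suc n))
         (∏-cong n λ {i} _ → solve 2 (λ x y → (con (+ 2) :- (con (+ 2) :+ x)) :+ ((con 1ℤ :+ y) :+ (con 1ℤ :+ y))
                                           := (con (+ 2) :- x) :+ (y :+ y)) refl (+ n) (+ i)))) ⟩
  weight (suc (suc n)) 0 * (∏ n (weight n) * weight (suc (suc n)) (suc n))
    ≡⟨ cong (λ P → weight (suc (suc n)) 0 * (P * weight (suc (suc n)) (suc n))) (∏-odd-range m) ⟩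
  weight (suc (suc n)) 0 * (-1ℤ ^ m * (O * O) * + n * weight (suc (suc n)) (suc n))
    ≡⟨ solve 3 (λ s O x →
         ((con (+ 2) :- (con (+ 2) :+ x)) :+ con 0ℤ) :*
           (s :* (O :* O) :* x :* ((con (+ 2) :- (con (+ 2) :+ x)) :+ ((con 1ℤ :+ x) :+ (con 1ℤ :+ x))))
         := con -1ℤ :* s :* ((O :* x) :* (O :* x)) :* (con (+ 2) :+ x)) refl (-1ℤ ^ m) O (+ n) ⟩
  -1ℤ ^ suc m * ((O * + n) * (O * + n)) * + suc (suc n)
    ≡⟨ cong₂ (λ P k → -1ℤ ^ suc m * (P * P) * + k) (∏-snoc m odd) (cong 2+ (ℕ.+-suc m m)) ⟨
  -1ℤ ^ suc m * (oddProduct (suc m) * oddProduct (suc m)) * + n′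
    ∎
  where
  open ≡-Reasoning
  n n′ : ℕ
  n  = suc (m ℕ.+ m)
  n′ = suc (suc m ℕ.+ suc m)
  O = oddProduct m
  weight : ℕ → ℕ → ℤ
  weight n i = (+ 2 - + n) + (+ i + + i)

-- homogeneous a n x y = Σ_{i<n} a i · x^(n-1-i) · y^i
homogeneous : (ℕ → ℤ) → ℕ → ℤ → ℤ → ℤ
homogeneous a zero    x y = 0ℤ
homogeneous a (suc n) x y = a 0 * x ^ n + y * homogeneous (a ∘ suc) n x y

homogeneous-* : ∀ {a b : ℕ → ℤ} e n x y → (∀ i → a i ≡ e * b i) → homogeneous a n x y ≡ e * homogeneous b n x y
homogeneous-* e zero    x y a≡eb = sym (ℤ.*-zeroʳ e)
homogeneous-* {b = b} e (suc n) x y a≡eb = trans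
  (cong₂ (λ c h → c * x ^ n + y * h) (a≡eb 0) (homogeneous-* e n x y (a≡eb ∘ suc)))
  (solve 5 (λ e b X y H → e :* b :* X :+ y :* (e :* H) := e :* (b :* X :+ y :* H)) refl
     e (b 0) (x ^ n) y (homogeneous (b ∘ suc) n x y))

-- Moves e from the second variable into the coefficients, so that both matrices of powers are built
-- on the same points.
homogeneous-scale : ∀ a e n x z → homogeneous (λ i → a i * e ^ i) n x z ≡ homogeneous a n x (e * z)
homogeneous-scale a e zero    x z = refl
homogeneous-scale a e (suc n) x z = begin
  a 0 * 1ℤ * x ^ n + z * homogeneous (λ i → a (suc i) * (e * e ^ i)) n x z
    ≡⟨ cong (λ t → a 0 * 1ℤ * x ^ n + z * t) (homogeneous-* e n x z (λ i → solve 3 (λ a e E → a :* (e :* E) := e :* (a :* E)) refl (a (suc i)) e (e ^ i))) ⟩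
  a 0 * 1ℤ * x ^ n + z * (e * homogeneous (λ i → a (suc i) * e ^ i) n x z)
    ≡⟨ cong (λ t → a 0 * 1ℤ * x ^ n + z * (e * t)) (homogeneous-scale (a ∘ suc) e n x z) ⟩
  a 0 * 1ℤ * x ^ n + z * (e * H)
    ≡⟨ solve 5 (λ a X z e H → a :* con 1ℤ :* X :+ z :* (e :* H) := a :* X :+ e :* z :* H) refl (a 0) (x ^ n) z e H ⟩
  a 0 * x ^ n + e * z * H
    ∎
  where
  open ≡-Reasoning
  H = homogeneous (a ∘ suc) n x (e * z)

geometric : ℕ → ℤ → ℤ → ℤ
geometric = homogeneous (λ _ → 1ℤ)

geometric-telescopes : ∀ n x y → (x - y) * geometric n x y ≡ x ^ n - y ^ n
geometric-telescopes zero    x y = ℤ.*-zeroʳ (x - y)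
geometric-telescopes (suc n) x y = begin
  (x - y) * (1ℤ * x ^ n + y * G)
    ≡⟨ solve 4 (λ x y X G → (x :- y) :* (con 1ℤ :* X :+ y :* G) := (x :- y) :* X :+ y :* ((x :- y) :* G))
         refl x y (x ^ n) G ⟩
  (x - y) * x ^ n + y * ((x - y) * G)
    ≡⟨ cong (λ t → (x - y) * x ^ n + y * t) (geometric-telescopes n x y) ⟩
  (x - y) * x ^ n + y * (x ^ n - y ^ n)
    ≡⟨ solve 4 (λ x y X Y → (x :- y) :* X :+ y :* (X :- Y) := x :* X :- y :* Y) refl x y (x ^ n) (y ^ n) ⟩
  x ^ suc n - y ^ suc n
    ∎
  where
  open ≡-Reasoning
  G = geometric n x y

geometric-diagonal : ∀ n x → geometric n x x ≡ + n * x ^ ℕ.pred n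
geometric-diagonal zero          x = refl
geometric-diagonal (suc zero)    x = solve 1 (λ x → con 1ℤ :* con 1ℤ :+ x :* con 0ℤ := con 1ℤ :* con 1ℤ) refl x
geometric-diagonal (suc (suc n)) x = trans (cong (λ t → 1ℤ * x ^ suc n + x * t) (geometric-diagonal (suc n) x))
  (solve 3 (λ x X k → con 1ℤ :* (x :* X) :+ x :* ((con 1ℤ :+ k) :* X) := (con 1ℤ :+ (con 1ℤ :+ k)) :* (x :* X))
     refl x (x ^ n) (+ n))

arithmetic : ℤ → ℕ → ℤ
arithmetic c i = c + (+ i + + i)

homogeneous-cong : ∀ {a b : ℕ → ℤ} n x y → (∀ i → a i ≡ b i) → homogeneous a n x y ≡ homogeneous b n x y
homogeneous-cong zero    x y a≡b = refl
homogeneous-cong (suc n) x y a≡b =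
  cong₂ (λ c h → c * x ^ n + y * h) (a≡b 0) (homogeneous-cong n x y (a≡b ∘ suc))

-- Summation by parts: multiplication by x - y replaces the coefficients by their differences, all
-- equal to 2, so that a geometric sum and boundary terms remain. A second multiplication by x - y
-- then removes that sum as well.
arithmetic-telescopes : ∀ c n x y → (x - y) * homogeneous (arithmetic c) n x y ≡
  + 2 * (y * geometric n x y) - + 2 * (+ n * y ^ n) + c * (x ^ n - y ^ n)
arithmetic-telescopes c zero    x y =
  solve 3 (λ x y c → (x :- y) :* con 0ℤ := con (+ 2) :* (y :* con 0ℤ) :- con (+ 2) :* (con 0ℤ :* con 1ℤ) :+ c :* (con 1ℤ :- con 1ℤ))
    refl x y c
arithmetic-telescopes c (suc n) x y = begin
  (x - y) * (arithmetic c 0 * X + y * homogeneous (arithmetic c ∘ suc) n x y)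
    ≡⟨ cong (λ t → (x - y) * (arithmetic c 0 * X + y * t)) (homogeneous-cong n x y λ i →
         solve 2 (λ c i → c :+ ((con 1ℤ :+ i) :+ (con 1ℤ :+ i)) := (c :+ con (+ 2)) :+ (i :+ i)) refl c (+ i)) ⟩
  (x - y) * (arithmetic c 0 * X + y * H)
    ≡⟨ solve 5 (λ x y X H c → (x :- y) :* ((c :+ con 0ℤ) :* X :+ y :* H) := (x :- y) :* (c :* X) :+ y :* ((x :- y) :* H))
         refl x y X H c ⟩
  (x - y) * (c * X) + y * ((x - y) * H)
    ≡⟨ cong (λ t → (x - y) * (c * X) + y * t) (arithmetic-telescopes (c + + 2) n x y) ⟩
  (x - y) * (c * X) + y * (+ 2 * (y * G) - + 2 * (+ n * Y) + (c + + 2) * (X - Y))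
    ≡⟨ solve 7 (λ x y X Y G k c →
         (x :- y) :* (c :* X) :+ y :* (con (+ 2) :* (y :* G) :- con (+ 2) :* (k :* Y) :+ (c :+ con (+ 2)) :* (X :- Y))
         := con (+ 2) :* (y :* (con 1ℤ :* X :+ y :* G)) :- con (+ 2) :* ((con 1ℤ :+ k) :* (y :* Y)) :+ c :* (x :* X :- y :* Y))
         refl x y X Y G (+ n) c ⟩
  + 2 * (y * geometric (suc n) x y) - + 2 * (+ suc n * y ^ suc n) + c * (x ^ suc n - y ^ suc n)
    ∎
  where
  open ≡-Reasoning
  X = x ^ n
  Y = y ^ n
  G = geometric n x y
  H = homogeneous (arithmetic (c + + 2)) n x y

-- The monic polynomial c₀ + c₁ T + ⋯ + cₙ₋₁ Tⁿ⁻¹ + Tⁿ.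
monic : ∀ {n} → Vec ℤ n → ℤ → ℤ
monic []       T = 1ℤ
monic (c ∷ cs) T = c + T * monic cs T

-- Horner's scheme: the coefficients of the quotient by T - r are the intermediate values at `r`.
-- The implicit leading 1 makes every quotient monic by construction.
quotient : ∀ {n} → Vec ℤ (suc n) → ℤ → Vec ℤ n
quotient {zero}  _        r = []
quotient {suc n} (_ ∷ cs) r = monic cs r ∷ quotient cs r

monic-quotient : ∀ {n} (cs : Vec ℤ (suc n)) r T →
                 monic cs T ≡ monic cs r + (T - r) * monic (quotient cs r) T
monic-quotient {zero}  (c ∷ [])     r T =
  solve 3 (λ c r T → c :+ T :* con 1ℤ := c :+ r :* con 1ℤ :+ (T :- r) :* con 1ℤ) refl c r T
monic-quotient {suc n} (c ∷ cs) r T = begin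
  c + T * monic cs T
    ≡⟨ cong (λ t → c + T * t) (monic-quotient cs r T) ⟩
  c + T * (monic cs r + (T - r) * Q)
    ≡⟨ solve 5 (λ c r T M Q → c :+ T :* (M :+ (T :- r) :* Q) := c :+ r :* M :+ (T :- r) :* (M :+ T :* Q))
         refl c r T (monic cs r) Q ⟩
  c + r * monic cs r + (T - r) * (monic cs r + T * Q)
    ∎
  where
  open ≡-Reasoning
  Q = monic (quotient cs r) T

monic-zeros : ∀ n T → monic (replicate n 0ℤ) T ≡ T ^ n
monic-zeros zero    T = refl
monic-zeros (suc n) T = trans (ℤ.+-identityˡ (T * monic (replicate n 0ℤ) T)) (cong (T *_) (monic-zeros n T))

-- Arithmetic modulo p

module Modular (p : ℕ) where

  infix 4 _≈_
  -- A record, so that unification recovers `a` and `b`, which the divisibility of `a - b` alone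
  -- would not determine.
  record _≈_ (a b : ℤ) : Set where
    constructor mod
    field p∣a-b : + p ∣ a - b

  open _≈_ public

  -- Congruences are derived from others as linear combinations with explicit
  -- coefficients, which leaves an integer identity to the ring solver.
  reduce₁ : ∀ {x y a b} c → x - y ≡ c * (a - b) → a ≈ b → x ≈ y
  reduce₁ c eq (mod d) = mod (≡.subst (+ p ∣_) (sym eq) (∣n⇒∣m*n c d))

  reduce₂ : ∀ {x y a₁ b₁ a₂ b₂} c₁ c₂ → x - y ≡ c₁ * (a₁ - b₁) + c₂ * (a₂ - b₂) →
            a₁ ≈ b₁ → a₂ ≈ b₂ → x ≈ y
  reduce₂ c₁ c₂ eq (mod d₁) (mod d₂) =
    mod (≡.subst (+ p ∣_) (sym eq) (∣m∣n⇒∣m+n (∣n⇒∣m*n c₁ d₁) (∣n⇒∣m*n c₂ d₂)))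

  reduce₃ : ∀ {x y a₁ b₁ a₂ b₂ a₃ b₃} c₁ c₂ c₃ →
            x - y ≡ c₁ * (a₁ - b₁) + c₂ * (a₂ - b₂) + c₃ * (a₃ - b₃) →
            a₁ ≈ b₁ → a₂ ≈ b₂ → a₃ ≈ b₃ → x ≈ y
  reduce₃ c₁ c₂ c₃ eq (mod d₁) (mod d₂) (mod d₃) = mod (≡.subst (+ p ∣_) (sym eq)
    (∣m∣n⇒∣m+n (∣m∣n⇒∣m+n (∣n⇒∣m*n c₁ d₁) (∣n⇒∣m*n c₂ d₂)) (∣n⇒∣m*n c₃ d₃)))

  ≈-reflexive : ∀ {a b} → a ≡ b → a ≈ b
  ≈-reflexive {a} refl = mod (divides 0ℤ (ℤ.+-inverseʳ a))

  ≈-refl : ∀ {a} → a ≈ a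
  ≈-refl = ≈-reflexive refl

  ≈-sym : ∀ {a b} → a ≈ b → b ≈ a
  ≈-sym {a} {b} = reduce₁ -1ℤ (solve 2 (λ a b → b :- a := con -1ℤ :* (a :- b)) refl a b)

  ≈-trans : ∀ {a b c} → a ≈ b → b ≈ c → a ≈ c
  ≈-trans {a} {b} {c} = reduce₂ 1ℤ 1ℤ
    (solve 3 (λ a b c → a :- c := con 1ℤ :* (a :- b) :+ con 1ℤ :* (b :- c)) refl a b c)

  +-cong : ∀ {a b c d} → a ≈ b → c ≈ d → a + c ≈ b + d
  +-cong {a} {b} {c} {d} = reduce₂ 1ℤ 1ℤ
    (solve 4 (λ a b c d → a :+ c :- (b :+ d) := con 1ℤ :* (a :- b) :+ con 1ℤ :* (c :- d)) refl a b c d)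

  *-cong : ∀ {a b c d} → a ≈ b → c ≈ d → a * c ≈ b * d
  *-cong {a} {b} {c} {d} = reduce₂ c b
    (solve 4 (λ a b c d → a :* c :- b :* d := c :* (a :- b) :+ b :* (c :- d)) refl a b c d)

  -‿cong : ∀ {a b} → a ≈ b → - a ≈ - b
  -‿cong {a} {b} = reduce₁ -1ℤ (solve 2 (λ a b → :- a :- (:- b) := con -1ℤ :* (a :- b)) refl a b)

  commutativeRing : CommutativeRing 0ℓ 0ℓ
  commutativeRing = record
    { Carrier = ℤ ; _≈_ = _≈_ ; _+_ = _+_ ; _*_ = _*_ ; -_ = -_ ; 0# = 0ℤ ; 1# = 1ℤ
    ; isCommutativeRing = record
      { isRing = record
        { +-isAbelianGroup = record
          { isGroup = record
            { isMonoid = record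
              { isSemigroup = record
                { isMagma = record
                  { isEquivalence = record { refl = ≈-refl ; sym = ≈-sym ; trans = ≈-trans }
                  ; ∙-cong = +-cong }
                ; assoc = λ a b c → ≈-reflexive (ℤ.+-assoc a b c) }
              ; identity = (≈-reflexive ∘ ℤ.+-identityˡ) , (≈-reflexive ∘ ℤ.+-identityʳ) }
            ; inverse = (≈-reflexive ∘ ℤ.+-inverseˡ) , (≈-reflexive ∘ ℤ.+-inverseʳ)
            ; ⁻¹-cong = -‿cong }
          ; comm = λ a b → ≈-reflexive (ℤ.+-comm a b) }
        ; *-cong = *-cong
        ; *-assoc = λ a b c → ≈-reflexive (ℤ.*-assoc a b c)
        ; *-identity = (≈-reflexive ∘ ℤ.*-identityˡ) , (≈-reflexive ∘ ℤ.*-identityʳ)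
        ; distrib = (λ a b c → ≈-reflexive (ℤ.*-distribˡ-+ a b c))
                  , (λ a b c → ≈-reflexive (ℤ.*-distribʳ-+ a b c)) }
      ; *-comm = λ a b → ≈-reflexive (ℤ.*-comm a b) } }

  open CommutativeRing commutativeRing public using (setoid)
  module ≈-Reasoning where
    open import Relation.Binary.Reasoning.Setoid setoid public

  ^-cong : ∀ {a b} n → a ≈ b → a ^ n ≈ b ^ n
  ^-cong zero    a≈b = ≈-refl
  ^-cong (suc n) a≈b = *-cong a≈b (^-cong n a≈b)

  ∏-≈-cong : ∀ n {f g : ℕ → ℤ} → (∀ {i} → i < n → f i ≈ g i) → ∏ n f ≈ ∏ n g
  ∏-≈-cong zero    f≈g = ≈-refl
  ∏-≈-cong (suc n) f≈g = *-cong (f≈g z<s) (∏-≈-cong n (f≈g ∘ s<s))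

  multiple≈0 : ∀ {k} → p ℕ.∣ k → + k ≈ 0ℤ
  multiple≈0 {k} p∣k = mod (≡.subst (+ p ∣_) (sym (ℤ.+-identityʳ (+ k))) (∣ᵤ⇒∣ p∣k))

  p≈0 : + p ≈ 0ℤ
  p≈0 = multiple≈0 ℕ.∣-refl

  ∣⇒≈0 : ∀ {a} → + p ∣ a → a ≈ 0ℤ
  ∣⇒≈0 {a} p∣a = mod (≡.subst (+ p ∣_) (sym (ℤ.+-identityʳ a)) p∣a)

  ≈0⇒∣ : ∀ {a} → a ≈ 0ℤ → + p ∣ a
  ≈0⇒∣ {a} (mod d) = ≡.subst (+ p ∣_) (ℤ.+-identityʳ a) d

  -≈0 : ∀ {a b} → a - b ≈ 0ℤ → a ≈ b
  -≈0 {a} {b} = reduce₁ 1ℤ (solve 2 (λ a b → a :- b := con 1ℤ :* (a :- b :- con 0ℤ)) refl a b)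

  ≈⇒-≈0 : ∀ {a b} → a ≈ b → a - b ≈ 0ℤ
  ≈⇒-≈0 {a} {b} = reduce₁ 1ℤ (solve 2 (λ a b → a :- b :- con 0ℤ := con 1ℤ :* (a :- b)) refl a b)

module PrimeModular (p : ℕ) (p-prime : Prime p) where
  open Modular p public

  instance
    p-nonZero : ℕ.NonZero p
    p-nonZero = prime⇒nonZero p-prime

  no-zero-divisors : ∀ a b → a * b ≈ 0ℤ → a ≈ 0ℤ ⊎ b ≈ 0ℤ
  no-zero-divisors a b ab≈0 =
    [ inj₁ ∘ ∣⇒≈0 ∘ ∣ᵤ⇒∣ , inj₂ ∘ ∣⇒≈0 ∘ ∣ᵤ⇒∣ ]′
      (euclidsLemma ℤ.∣ a ∣ ℤ.∣ b ∣ p-prime (≡.subst (p ℕ.∣_) (ℤ.abs-* a b) (∣⇒∣ᵤ (≈0⇒∣ ab≈0))))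

  *-≉0 : ∀ a b → ¬ a ≈ 0ℤ → ¬ b ≈ 0ℤ → ¬ a * b ≈ 0ℤ
  *-≉0 a b a≉0 b≉0 ab≈0 = [ a≉0 , b≉0 ]′ (no-zero-divisors a b ab≈0)

  cancelˡ : ∀ a b c → ¬ a ≈ 0ℤ → a * b ≈ a * c → b ≈ c
  cancelˡ a b c a≉0 ab≈ac = [ ⊥-elim ∘ a≉0 , -≈0 ]′ (no-zero-divisors a (b - c)
    (reduce₁ 1ℤ (solve 3 (λ a b c → a :* (b :- c) :- con 0ℤ := con 1ℤ :* (a :* b :- a :* c)) refl a b c) ab≈ac))

  <p⇒≉0 : ∀ {k} → suc k < p → ¬ + suc k ≈ 0ℤ
  <p⇒≉0 {k} k<p k≈0 = ℕ.<⇒≱ k<p (ℕ.∣⇒≤ (∣⇒∣ᵤ (≈0⇒∣ k≈0)))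

  1≉0 : ¬ 1ℤ ≈ 0ℤ
  1≉0 = <p⇒≉0 (ℕ.nonTrivial⇒n>1 p ⦃ prime⇒nonTrivial p-prime ⦄)

  ^-≉0 : ∀ a n → ¬ a ≈ 0ℤ → ¬ a ^ n ≈ 0ℤ
  ^-≉0 a zero    a≉0 = 1≉0
  ^-≉0 a (suc n) a≉0 = *-≉0 a (a ^ n) a≉0 (^-≉0 a n a≉0)

  ∏-≉0 : ∀ n f → (∀ {i} → i < n → ¬ f i ≈ 0ℤ) → ¬ ∏ n f ≈ 0ℤ
  ∏-≉0 zero    f f≉0 = 1≉0
  ∏-≉0 (suc n) f f≉0 = *-≉0 (f 0) (∏ n (f ∘ suc)) (f≉0 z<s) (∏-≉0 n (f ∘ suc) (f≉0 ∘ s<s))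

  ∏-≈0 : ∀ n f → ∏ n f ≈ 0ℤ → ∃[ i ] (i < n × f i ≈ 0ℤ)
  ∏-≈0 zero    f 1≈0 = ⊥-elim (1≉0 1≈0)
  ∏-≈0 (suc n) f ∏≈0 with no-zero-divisors (f 0) (∏ n (f ∘ suc)) ∏≈0
  ... | inj₁ f0≈0 = 0 , z<s , f0≈0
  ... | inj₂ rest≈0 with ∏-≈0 n (f ∘ suc) rest≈0
  ...   | i , i<n , fi≈0 = suc i , s<s i<n , fi≈0

  -- The synthetic division of a monic polynomial by T - r, where r is a root,
  -- leaves a monic polynomial that vanishes at the remaining roots.
  monic-factors : ∀ {n} (cs : Vec ℤ n) (r : ℕ → ℤ) → (∀ {i} → i < n → monic cs (r i) ≈ 0ℤ) →
                  (∀ {i j} → i < j → j < n → ¬ r i ≈ r j) →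
                  ∀ T → monic cs T ≈ ∏ n (λ i → T - r i)
  monic-factors []       r roots distinct T = ≈-refl
  monic-factors {suc n} cs r roots distinct T = ≈-trans
    (reduce₁ 1ℤ (trans (cong (_- (T - r 0) * Q T) (monic-quotient cs (r 0) T))
        (solve 2 (λ a b → a :+ b :- b := con 1ℤ :* (a :- con 0ℤ)) refl (monic cs (r 0)) ((T - r 0) * Q T)))
      (roots z<s))
    (*-cong (≈-refl {T - r 0}) (monic-factors (quotient cs (r 0)) (r ∘ suc) quotient-roots
      (λ i<j j<n → distinct (s<s i<j) (s<s j<n)) T))
    where
    Q : ℤ → ℤ
    Q = monic (quotient cs (r 0))

    quotient-roots : ∀ {i} → i < n → Q (r (suc i)) ≈ 0ℤ
    quotient-roots {i} i<n = [ (λ r′≈r → ⊥-elim (distinct z<s (s<s i<n) (≈-sym (-≈0 r′≈r)))) , (λ Q≈0 → Q≈0) ]′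
      (no-zero-divisors (r (suc i) - r 0) (Q (r (suc i)))
        (reduce₂ 1ℤ -1ℤ (trans (solve 2 (λ m q → q :- con 0ℤ := con 1ℤ :* (m :+ q :- con 0ℤ) :+ con -1ℤ :* (m :- con 0ℤ)) refl (monic cs (r 0)) ((r (suc i) - r 0) * Q (r (suc i))))
           (cong (λ t → 1ℤ * (t - 0ℤ) + -1ℤ * (monic cs (r 0) - 0ℤ)) (sym (monic-quotient cs (r 0) (r (suc i)))))) (roots (s<s i<n)) (roots z<s)))

-- Fermat's little theorem

prime∤! : ∀ {p} → Prime p → ∀ k → k < p → ¬ p ℕ.∣ k !
prime∤! p-prime zero    0<p p∣1  = ℕ.<⇒≱ (ℕ.nonTrivial⇒n>1 _ ⦃ prime⇒nonTrivial p-prime ⦄) (ℕ.∣⇒≤ p∣1)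
prime∤! p-prime (suc k) k<p p∣k! =
  [ (λ p∣k → ℕ.<⇒≱ k<p (ℕ.∣⇒≤ p∣k)) , prime∤! p-prime k (ℕ.<-trans (ℕ.n<1+n k) k<p) ]′
    (euclidsLemma (suc k) (k !) p-prime p∣k!)

-- p divides p! = C(p,k) · k! · (p - k)!, but neither of the two factorials.
prime∣C : ∀ {p} → Prime p → ∀ k → 0 < k → k < p → p ℕ.∣ p C k
prime∣C {zero}     p-prime k 0<k ()
prime∣C {p@(suc q)} p-prime k 0<k k<p =
  [ (λ p∣C → p∣C) , (λ p∣k!l! → ⊥-elim ([ prime∤! p-prime k k<p , prime∤! p-prime (p ∸ k) (ℕ.∸-monoʳ-< 0<k (ℕ.<⇒≤ k<p)) ]′
      (euclidsLemma (k !) ((p ∸ k) !) p-prime p∣k!l!))) ]′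
    (euclidsLemma (p C k) (k ! ℕ.* (p ∸ k) !) p-prime
      (≡.subst (p ℕ.∣_) (sym C*k!l!≡p!) (ℕ.∣m⇒∣m*n (q !) ℕ.∣-refl)))
  where
  instance _ = k ℕ.!* (p ∸ k) !≢0
  k≤p = ℕ.<⇒≤ k<p
  C*k!l!≡p! : (p C k) ℕ.* (k ! ℕ.* (p ∸ k) !) ≡ p !
  C*k!l!≡p! = trans (cong (ℕ._* (k ! ℕ.* (p ∸ k) !)) (nCk≡n!/k![n-k]! k≤p)) (ℕ.m/n*n≡m (k![n∸k]!∣n! k≤p))

module Fermat (p : ℕ) (p-prime : Prime p) where
  open PrimeModular p p-prime
  private
    module R = CommutativeRing commutativeRing
    module Exp = RawSemiringDefs (Semiring.rawSemiring R.semiring)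
    module Σ = Sum R.semiring

  exp≡^ : ∀ a n → a Exp.^ n ≡ a ^ n
  exp≡^ a zero    = refl
  exp≡^ a (suc n) = cong (a *_) (exp≡^ a n)

  ×≡* : ∀ k a → k Exp.× a ≡ + k * a
  ×≡* zero    a = refl
  ×≡* (suc k) a = trans (cong (λ t → a + t) (×≡* k a)) (solve 2 (λ a k → a :+ k :* a := (con 1ℤ :+ k) :* a) refl a (+ k))

  frobenius : ∀ a → (a + 1ℤ) ^ p ≈ a ^ p + 1ℤ
  frobenius a = go p refl
    where
    open ≈-Reasoning
    term : ∀ q → Fin (suc q) → ℤ
    term q = Binomial.binomialTerm R.commutativeSemiring a 1ℤ q

    term≡ : ∀ q k → term q k ≡ + (q C toℕ k) * (a ^ toℕ k)
    term≡ q k = trans (×≡* (q C toℕ k) _) (cong (+ (q C toℕ k) *_)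
      (trans (cong₂ _*_ (exp≡^ a (toℕ k)) (trans (exp≡^ 1ℤ (q ∸ toℕ k)) (ℤ.^-zeroˡ (q ∸ toℕ k)))) (ℤ.*-identityʳ (a ^ toℕ k))))

    -- The congruence is fixed to the parameter `p`; a separate exponent q can be matched as a
    -- successor, which lets the first and last binomial terms be split off.
    go : ∀ q → q ≡ p → (a + 1ℤ) ^ q ≈ a ^ q + 1ℤ
    go zero    0≡p = ⊥-elim (ℕ.≢-nonZero⁻¹ p (sym 0≡p))
    go q@(suc r) q≡p = begin
      (a + 1ℤ) ^ q
        ≡⟨ exp≡^ (a + 1ℤ) q ⟨
      (a + 1ℤ) Exp.^ q
        ≈⟨ Binomial.theorem R.commutativeSemiring q a 1ℤ ⟩
      term q zero + Σ.sum (term q ∘ suc)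
        ≈⟨ +-cong (≈-refl {term q zero}) (Σ.sum-init-last (term q ∘ suc)) ⟩
      term q zero + (Σ.sum (λ i → term q (suc (inject₁ i))) + term q (suc (fromℕ r)))
        ≈⟨ +-cong (≈-refl {term q zero}) (+-cong (≈-trans (Σ.sum-cong-≋ middle) (Σ.sum-replicate-zero r))
             (≈-refl {term q (suc (fromℕ r))})) ⟩
      term q zero + (0ℤ + term q (suc (fromℕ r)))
        ≡⟨ cong₂ (λ s t → s + (0ℤ + t)) (term≡ q zero)
             (trans (term≡ q (suc (fromℕ r))) (trans (cong (λ k → + (q C suc k) * a ^ suc k) (Fin.toℕ-fromℕ r))
               (cong (λ k → + k * a ^ q) (nCn≡1 q)))) ⟩
      + (q C 0) * 1ℤ + (0ℤ + 1ℤ * a ^ q)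
        ≡⟨ cong (λ k → + k * 1ℤ + (0ℤ + 1ℤ * a ^ q)) (trans (nCk≡nC[n∸k] {0} {q} ℕ.z≤n) (nCn≡1 q)) ⟩
      1ℤ * 1ℤ + (0ℤ + 1ℤ * a ^ q)
        ≡⟨ solve 1 (λ x → con 1ℤ :* con 1ℤ :+ (con 0ℤ :+ con 1ℤ :* x) := x :+ con 1ℤ) refl (a ^ q) ⟩
      a ^ q + 1ℤ
        ∎
      where
      middle : ∀ i → term q (suc (inject₁ i)) ≈ 0ℤ
      middle i = ≈-trans (≈-reflexive (term≡ q (suc (inject₁ i))))
        (*-cong {d = a ^ toℕ (suc (inject₁ i))} (multiple≈0 (≡.subst (λ s → p ℕ.∣ s C k) (sym q≡p) (prime∣C p-prime k z<s k<p))) ≈-refl)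
        where
        k = suc (toℕ (inject₁ i))
        k<p : k < p
        k<p = ≡.subst (k <_) q≡p (s<s (≡.subst (_< r) (sym (Fin.toℕ-inject₁ i)) (Fin.toℕ<n i)))

  residue : ∀ a → a ≈ + (a %ℕ p)
  residue a = mod (divides (a /ℕ p) (trans (cong (_- + (a %ℕ p)) (a≡a%ℕn+[a/ℕn]*n a p))
    (solve 2 (λ r k → r :+ k :- r := k) refl (+ (a %ℕ p)) ((a /ℕ p) * + p))))

  ^p≈id : ∀ a → a ^ p ≈ a
  ^p≈id a = ≈-trans (^-cong p (residue a)) (≈-trans (natural (a %ℕ p)) (≈-sym (residue a)))
    where
    natural : ∀ k → (+ k) ^ p ≈ + k
    natural zero    = ≈-reflexive (0^n p)
      where
      0^n : ∀ n ⦃ _ : ℕ.NonZero n ⦄ → 0ℤ ^ n ≡ 0ℤ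
      0^n (suc n) = refl
    natural (suc k) = ≈-trans (≈-reflexive (cong (_^ p) (ℤ.+-comm 1ℤ (+ k))))
      (≈-trans (frobenius (+ k)) (≈-trans (+-cong (natural k) (≈-refl {1ℤ})) (≈-reflexive (ℤ.+-comm (+ k) 1ℤ))))

  fermat : ∀ a k → p ≡ suc k → ¬ a ≈ 0ℤ → a ^ k ≈ 1ℤ
  fermat a k p≡1+k a≉0 = cancelˡ a (a ^ k) 1ℤ a≉0
    (≈-trans (≈-reflexive (cong (a ^_) (sym p≡1+k))) (≈-trans (^p≈id a) (≈-reflexive (sym (ℤ.*-identityʳ a)))))

-- Quadratic residues

-- Shifted by one and written as a power so as to agree definitionally with the terms of `form`.
square : ℕ → ℤ
square i = (+ suc i) ^ 2

data IsSign : ℤ → Set where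
  is-0  : IsSign 0ℤ
  is-1  : IsSign 1ℤ
  is--1 : IsSign -1ℤ

-1^n*-1^n : ∀ n → -1ℤ ^ n * -1ℤ ^ n ≡ 1ℤ
-1^n*-1^n n = trans (sym (^-distribʳ-* -1ℤ -1ℤ n)) (ℤ.^-zeroˡ n)

^2^n : ∀ a n → (a ^ 2) ^ n ≡ a ^ (n ℕ.+ n)
^2^n a n = trans (cong (_^ n) (cong (a *_) (ℤ.*-identityʳ a))) (sym (^-double a n))

module OddPrime (p ν : ℕ) (p-prime : Prime p) (p≡1+2n : p ≡ suc (suc ν ℕ.+ suc ν)) where
  open Fermat p p-prime public
  open PrimeModular p p-prime public

  n : ℕ
  n = suc ν

  1+2n≈0 : 1ℤ + (+ n + + n) ≈ 0ℤ
  1+2n≈0 = ≡.subst (_≈ 0ℤ) (cong +_ p≡1+2n) p≈0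

  n+n<p : n ℕ.+ n < p
  n+n<p = ℕ.≤-reflexive (sym p≡1+2n)

  n<p : n < p
  n<p = ℕ.≤-<-trans (ℕ.m≤m+n n n) n+n<p

  2≉0 : ¬ + 2 ≈ 0ℤ
  2≉0 = <p⇒≉0 (ℕ.≤-<-trans (ℕ.+-mono-≤ (s≤s (z≤n {ν})) (s≤s (z≤n {ν}))) n+n<p)

  -- The integer (p + 1)/2 = n + 1, an inverse of 2 modulo `p`.
  ½ : ℤ
  ½ = + suc n

  2½≈1 : + 2 * ½ ≈ 1ℤ
  2½≈1 = reduce₁ 1ℤ (solve 1 (λ n → con (+ 2) :* (con 1ℤ :+ n) :- con 1ℤ := con 1ℤ :* (con 1ℤ :+ (n :+ n) :- con 0ℤ)) refl (+ n)) 1+2n≈0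

  ½≉0 : ¬ ½ ≈ 0ℤ
  ½≉0 ½≈0 = 1≉0 (≈-trans (≈-sym 2½≈1) (reduce₁ (+ 2) (solve 1 (λ h → con (+ 2) :* h :- con 0ℤ := con (+ 2) :* (h :- con 0ℤ)) refl ½) ½≈0))

  n≈-½ : + n ≈ - ½
  n≈-½ = reduce₁ 1ℤ (solve 1 (λ n → n :- (:- (con 1ℤ :+ n)) := con 1ℤ :* (con 1ℤ :+ (n :+ n) :- con 0ℤ)) refl (+ n)) 1+2n≈0

  fermat′ : ∀ a → ¬ a ≈ 0ℤ → a ^ (n ℕ.+ n) ≈ 1ℤ
  fermat′ a = fermat a (n ℕ.+ n) p≡1+2n

  positive≉0 : ∀ {i} → i < n → ¬ + suc i ≈ 0ℤ
  positive≉0 i<n = <p⇒≉0 (ℕ.≤-<-trans i<n n<p)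

  square^n≈1 : ∀ {i} → i < n → square i ^ n ≈ 1ℤ
  square^n≈1 {i} i<n = ≈-trans (≈-reflexive (^2^n (+ suc i) n)) (fermat′ (+ suc i) (positive≉0 i<n))

  -- The difference of the squares of j + 1 and i + 1 is (j - i)(i + j + 2), and both factors lie
  -- strictly between 0 and p.
  squares-distinct : ∀ {i j} → i < j → j < n → ¬ square i ≈ square j
  squares-distinct {i} {j} i<j j<n i²≈j² with ℕ.m≤n⇒∃[o]m+o≡n i<j
  ... | k , refl = *-≉0 (+ suc k) (+ (suc i ℕ.+ suc j)) (positive≉0 (ℕ.≤-<-trans (ℕ.m≤n+m k (suc i)) j<n))
      (<p⇒≉0 (ℕ.≤-<-trans (ℕ.+-mono-≤ (ℕ.<-trans i<j j<n) j<n) n+n<p))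
      (reduce₁ -1ℤ (solve 2 (λ i k →
          (con 1ℤ :+ k) :* ((con 1ℤ :+ i) :+ (con 1ℤ :+ (con 1ℤ :+ i :+ k))) :- con 0ℤ
          := con -1ℤ :* ((con 1ℤ :+ i) :* ((con 1ℤ :+ i) :* con 1ℤ)
             :- (con 1ℤ :+ (con 1ℤ :+ i :+ k)) :* ((con 1ℤ :+ (con 1ℤ :+ i :+ k)) :* con 1ℤ))) refl (+ i) (+ k)) i²≈j²)

  -- The squares of 1, …, n are the n distinct roots of Tⁿ - 1.
  ^n-1-factors : ∀ T → T ^ n - 1ℤ ≈ ∏ n (λ i → T - square i)
  ^n-1-factors T = ≈-trans (≈-reflexive (sym (monic≡ T))) (monic-factors (-1ℤ ∷ replicate ν 0ℤ) square
    (λ {i} i<n → ≈-trans (≈-reflexive (monic≡ (square i))) (≈⇒-≈0 (square^n≈1 i<n))) squares-distinct T)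
    where
    monic≡ : ∀ T → -1ℤ + T * monic (replicate ν 0ℤ) T ≡ T ^ n - 1ℤ
    monic≡ T = trans (ℤ.+-comm -1ℤ (T * monic (replicate ν 0ℤ) T)) (cong (λ t → T * t - 1ℤ) (monic-zeros ν T))

  ∏square : ∏ n square ≈ - (-1ℤ ^ n)
  ∏square = reduce₁ (- s) P+s≡
    (≈-trans (^n-1-factors 0ℤ) (≈-reflexive (trans (∏-cong n λ {i} _ → trans (ℤ.+-identityˡ (- square i)) (sym (ℤ.-1*i≡-i (square i))))
      (trans (∏-* n (λ _ → -1ℤ) square) (cong (_* P) (∏-const n -1ℤ))))))
    where
    P = ∏ n square
    s = -1ℤ ^ n
    P+s≡ : P - - s ≡ - s * (-1ℤ - s * P)
    P+s≡ = begin
      P - - s              ≡⟨ solve 2 (λ P s → P :- (:- s) := P :* con 1ℤ :+ s) refl P s ⟩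
      P * 1ℤ + s           ≡⟨ cong (λ t → P * t + s) (-1^n*-1^n n) ⟨
      P * (s * s) + s      ≡⟨ solve 2 (λ P s → P :* (s :* s) :+ s := (:- s) :* (con -1ℤ :- s :* P)) refl P s ⟩
      - s * (-1ℤ - s * P)  ∎
      where open ≡-Reasoning

  square^n : ∀ {a} x → ¬ a ≈ 0ℤ → x ^ 2 ≈ a → a ^ n ≈ 1ℤ
  square^n x a≉0 x²≈a = ≈-trans (^-cong n (≈-sym x²≈a)) (≈-trans (≈-reflexive (^2^n x n)) (fermat′ x
    λ x≈0 → a≉0 (≈-trans (≈-sym x²≈a) (*-cong {d = x * 1ℤ} x≈0 ≈-refl))))

  -- a^(2n) = 1 leaves only a^n = 1 or a^n = -1. In the first case a is a root of Tⁿ - 1, and the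
  -- factorisation makes it one of the squares.
  nonsquare^n : ∀ {a} → ¬ a ≈ 0ℤ → (∀ {i} → i < n → ¬ square i ≈ a) → a ^ n ≈ -1ℤ
  nonsquare^n {a} a≉0 nonsquare =
    [ (λ aⁿ-1≈0 → ⊥-elim (no-root (∏-≈0 n (λ i → a - square i) (≈-trans (≈-sym (^n-1-factors a)) aⁿ-1≈0)))) , -≈0 ]′
      (no-zero-divisors (a ^ n - 1ℤ) (a ^ n - -1ℤ) (factors≈0 (a ^ n) (a ^ (n ℕ.+ n)) (ℤ.^-distribˡ-+-* a n n) (fermat′ a a≉0)))
    where
    no-root : ¬ (∃[ i ] (i < n × a - square i ≈ 0ℤ))
    no-root (i , i<n , a-i²≈0) = nonsquare i<n (≈-sym (-≈0 a-i²≈0))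

    factors≈0 : ∀ x y → y ≡ x * x → y ≈ 1ℤ → (x - 1ℤ) * (x - -1ℤ) ≈ 0ℤ
    factors≈0 x _ refl = reduce₁ 1ℤ
      (solve 1 (λ x → (x :- con 1ℤ) :* (x :- con -1ℤ) :- con 0ℤ := con 1ℤ :* (x :* x :- con 1ℤ)) refl x)

  square⇒IsSquareMod : ∀ {a i} → i < n → square i ≈ a → IsSquareMod a p
  square⇒IsSquareMod {a} {i} i<n i²≈a = fromℕ< i<p ,
    p∣a-b (≡.subst (λ k → (+ k) ^ 2 ≈ a) (sym (Fin.toℕ-fromℕ< i<p)) i²≈a)
    where
    i<p : suc i < p
    i<p = ℕ.≤-<-trans i<n n<p

  legendre-sign : ∀ a → IsSign (legendre a p)
  legendre-sign a with + p ∣? a | isSquareMod? a p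
  ... | yes _ | _     = is-0
  ... | no _  | yes _ = is-1
  ... | no _  | no _  = is--1

  -- Euler's criterion; the case of a divisible by `p` relies on n being a successor.
  legendre≈^n : ∀ a → legendre a p ≈ a ^ n
  legendre≈^n a with + p ∣? a | isSquareMod? a p
  ... | yes p∣a | _            = ≈-sym (*-cong {d = a ^ ν} (∣⇒≈0 p∣a) ≈-refl)
  ... | no p∤a  | yes (x , p∣) = ≈-sym (square^n (+ toℕ x) (p∤a ∘ ≈0⇒∣) (mod p∣))
  ... | no p∤a  | no ¬square   = ≈-sym (nonsquare^n (p∤a ∘ ≈0⇒∣) λ i<n i²≈a → ¬square (square⇒IsSquareMod i<n i²≈a))

  -- 0, 1 and -1 are pairwise incongruent because p is odd. This turns congruences between Legendre
  -- symbols into equalities.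
  sign-≈⇒≡ : ∀ {a b} → IsSign a → IsSign b → a ≈ b → a ≡ b
  sign-≈⇒≡ is-0     is-0     eq = refl
  sign-≈⇒≡ is-0     is-1 eq = ⊥-elim (1≉0 (≈-sym eq))
  sign-≈⇒≡ is-0     is--1 eq = ⊥-elim (1≉0 (-‿cong (≈-sym eq)))
  sign-≈⇒≡ is-1 is-0     eq = ⊥-elim (1≉0 eq)
  sign-≈⇒≡ is-1 is-1 eq = refl
  sign-≈⇒≡ is-1 is--1 eq = ⊥-elim (2≉0 (reduce₁ 1ℤ refl eq))
  sign-≈⇒≡ is--1 is-0     eq = ⊥-elim (1≉0 (-‿cong eq))
  sign-≈⇒≡ is--1 is-1 eq = ⊥-elim (2≉0 (reduce₁ -1ℤ refl eq))
  sign-≈⇒≡ is--1 is--1 eq = refl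

  legendre≡ : ∀ {a b} → IsSign b → a ^ n ≈ b → legendre a p ≡ b
  legendre≡ {a} b-sign aⁿ≈b = sign-≈⇒≡ (legendre-sign a) b-sign (≈-trans (legendre≈^n a) aⁿ≈b)

-- Determinants modulo p

-1^-cases : ∀ k → -1ℤ ^ k ≡ 1ℤ ⊎ -1ℤ ^ k ≡ -1ℤ
-1^-cases zero    = inj₁ refl
-1^-cases (suc k) = [ (λ eq → inj₂ (cong (-1ℤ *_) eq)) , (λ eq → inj₁ (cong (-1ℤ *_) eq)) ]′ (-1^-cases k)

-- k² has the parity of k.
-1^k^k : ∀ k → (-1ℤ ^ k) ^ k ≡ -1ℤ ^ k
-1^k^k k = [ (λ eq → trans (cong (_^ k) eq) (trans (ℤ.^-zeroˡ k) (sym eq))) , (λ eq → cong (_^ k) eq) ]′ (-1^-cases k)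

module HomogeneousDeterminant (p : ℕ) where
  open Modular p
  open Determinant commutativeRing using (Matrix; ∑; ∑-zero; ∑-suc; ∑-cong; *-∑; ∥_∥; _·_; det-cong; det-·; det-scaleRows; det-diagonal)
  open RawSemiringDefs (Semiring.rawSemiring (CommutativeRing.semiring commutativeRing)) using (product)

  product≡∏ : ∀ n f → product {n} (f ∘ toℕ) ≡ ∏ n f
  product≡∏ zero    f = refl
  product≡∏ (suc n) f = cong (f 0 *_) (product≡∏ n (f ∘ suc))

  ∑-homogeneous : ∀ a n x y → ∑ (λ (i : Fin n) → x ^ (n ∸ suc (toℕ i)) * (a (toℕ i) * y ^ toℕ i)) ≈ homogeneous a n x y
  ∑-homogeneous a zero    x y = ∑-zero _
  ∑-homogeneous a (suc n) x y = ≈-trans (∑-suc _) (+-cong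
    (≈-reflexive (solve 2 (λ X a → X :* (a :* con 1ℤ) := a :* X) refl (x ^ n) (a 0)))
    (≈-trans (∑-cong λ i → ≈-reflexive (solve 4 (λ X a y Y → X :* (a :* (y :* Y)) := y :* (X :* (a :* Y))) refl
        (x ^ (n ∸ suc (toℕ i))) (a (suc (toℕ i))) y (y ^ toℕ i)))
      (≈-trans (*-∑ y (λ (i : Fin n) → x ^ (n ∸ suc (toℕ i)) * (a (suc (toℕ i)) * y ^ toℕ i)))
        (*-cong (≈-refl {y}) (∑-homogeneous (a ∘ suc) n x y)))))

  module _ (n : ℕ) (r a x : ℕ → ℤ)
           (orthogonal : ∀ {i j : Fin n} → i ≢ j → geometric n (x (toℕ i)) (x (toℕ j)) ≈ 0ℤ) where
    private
      -- `C` is `B` with the diagonal matrix of the coefficients already multiplied in.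
      A B C : Matrix n n
      A i k = x (toℕ i) ^ (n ∸ suc (toℕ k))
      B k j = x (toℕ j) ^ toℕ k
      C k j = a (toℕ k) * B k j

      A·B≈geometric : ∀ i j → (A · B) i j ≈ geometric n (x (toℕ i)) (x (toℕ j))
      A·B≈geometric i j = ≈-trans
        (∑-cong λ k → ≈-reflexive (cong (A i k *_) (sym (ℤ.*-identityˡ (B k j)))))
        (∑-homogeneous (λ _ → 1ℤ) n (x (toℕ i)) (x (toℕ j)))

      det-A·B : ∥ A · B ∥ ≈ ∏ n (λ i → + n * x i ^ ℕ.pred n)
      det-A·B = ≈-trans (det-cong A·B≈geometric) (≈-trans (det-diagonal (λ i j → geometric n (x (toℕ i)) (x (toℕ j))) (λ i j i≢j → orthogonal i≢j))
        (≈-reflexive (trans (product≡∏ n (λ i → geometric n (x i) (x i))) (∏-cong n λ {i} _ → geometric-diagonal n (x i)))))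

    -- The diagonal of coefficients stands between `A` and `B`, so the matrix itself is not
    -- diagonal. Once determinants are taken the scalar can be moved out, and the two remaining
    -- factors recombine to the determinant of `A · B`.
    det-homogeneous : ∥ (λ i j → r (toℕ i) * homogeneous a n (x (toℕ i)) (x (toℕ j))) ∥
                      ≈ ∏ n r * (∏ n a * ∏ n (λ i → + n * x i ^ ℕ.pred n))
    det-homogeneous = begin
      ∥ (λ i j → r (toℕ i) * homogeneous a n (x (toℕ i)) (x (toℕ j))) ∥
        ≈⟨ det-cong (λ i j → *-cong (≈-refl {r (toℕ i)}) (≈-sym (∑-homogeneous a n (x (toℕ i)) (x (toℕ j))))) ⟩
      ∥ (λ i j → r (toℕ i) * (A · C) i j) ∥
        ≈⟨ det-scaleRows (r ∘ toℕ) (A · C) ⟩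
      product {n} (r ∘ toℕ) * ∥ A · C ∥
        ≈⟨ *-cong (≈-reflexive (product≡∏ n r)) (≈-trans (det-· A C) (*-cong (≈-refl {∥ A ∥})
             (≈-trans (det-scaleRows (a ∘ toℕ) B) (*-cong (≈-reflexive (product≡∏ n a)) (≈-refl {∥ B ∥}))))) ⟩
      ∏ n r * (∥ A ∥ * (∏ n a * ∥ B ∥))
        ≡⟨ cong (∏ n r *_) (solve 3 (λ A a B → A :* (a :* B) := a :* (A :* B)) refl (∥ A ∥) (∏ n a) (∥ B ∥)) ⟩
      ∏ n r * (∏ n a * (∥ A ∥ * ∥ B ∥))
        ≈⟨ *-cong (≈-refl {∏ n r}) (*-cong (≈-refl {∏ n a}) (≈-trans (≈-sym (det-· A B)) det-A·B)) ⟩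
      ∏ n r * (∏ n a * ∏ n (λ i → + n * x i ^ ℕ.pred n))
        ∎
      where open ≈-Reasoning

module InverseDeterminants (p ν : ℕ) (p-prime : Prime p) (p≡1+2n : p ≡ suc (suc ν ℕ.+ suc ν)) where
  open OddPrime p ν p-prime p≡1+2n public
  open Determinant commutativeRing using (Matrix; ∥_∥; det-cong)
  open HomogeneousDeterminant p using (det-homogeneous)

  -- The matrix entries are given only as inverses of the form; uniqueness identifies them with the
  -- explicit polynomials.
  inverse-unique : ∀ {u a b} → u * a ≈ 1ℤ → u * b ≈ 1ℤ → a ≈ b
  inverse-unique {u} {a} {b} = reduce₂ b (- a)
    (solve 3 (λ u a b → a :- b := b :* (u :* a :- con 1ℤ) :+ (:- a) :* (u :* b :- con 1ℤ)) refl u a b)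

  -- Multiplied by the nonzero x - y, the sum becomes xⁿ - yⁿ, which is 1 - 1.
  squares-orthogonal : ∀ {i j : Fin n} → i ≢ j → geometric n (square (toℕ i)) (square (toℕ j)) ≈ 0ℤ
  squares-orthogonal {i} {j} i≢j = cancelˡ (x - y) (geometric n x y) 0ℤ x-y≉0
    (≈-trans (≈-reflexive (geometric-telescopes n x y))
      (≈-trans (≈⇒-≈0 (≈-trans (square^n≈1 (Fin.toℕ<n i)) (≈-sym (square^n≈1 (Fin.toℕ<n j)))))
        (≈-reflexive (sym (ℤ.*-zeroʳ (x - y))))))
    where
    x = square (toℕ i)
    y = square (toℕ j)
    x-y≉0 : ¬ x - y ≈ 0ℤ
    x-y≉0 x-y≈0 with ℕ.<-cmp (toℕ i) (toℕ j)
    ... | tri< i<j _ _ = squares-distinct i<j (Fin.toℕ<n j) (-≈0 x-y≈0)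
    ... | tri≈ _ i≡j _ = i≢j (Fin.toℕ-injective i≡j)
    ... | tri> _ _ j<i = squares-distinct j<i (Fin.toℕ<n i) (≈-sym (-≈0 x-y≈0))

  ∏square^ν : ∏ n square ^ ν ≈ - (-1ℤ ^ n)
  ∏square^ν = ≈-trans (^-cong ν ∏square) (≈-reflexive (trans (cong (_^ ν) t≡) (trans (-1^k^k ν) (sym t≡))))
    where
    t≡ : - (-1ℤ ^ n) ≡ -1ℤ ^ ν
    t≡ = solve 1 (λ t → :- (con -1ℤ :* t) := t) refl (-1ℤ ^ ν)

  ½^n*½^n≈1 : ½ ^ n * ½ ^ n ≈ 1ℤ
  ½^n*½^n≈1 = ≈-trans (≈-reflexive (sym (ℤ.^-distribˡ-+-* ½ n n))) (fermat′ ½ ½≉0)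

  -- n is congruent to -1/2, so the constant factors contribute (-1)ⁿ ½ⁿ; the squares contribute
  -- -(-1)ⁿ, and the powers of -1 cancel.
  ∏-diagonal : ∏ n (λ i → + n * square i ^ ν) ≈ - (½ ^ n)
  ∏-diagonal = begin
    ∏ n (λ i → + n * square i ^ ν)
      ≡⟨ trans (∏-* n (λ _ → + n) (λ i → square i ^ ν)) (cong₂ _*_ (∏-const n (+ n)) (∏-^ n square ν)) ⟩
    (+ n) ^ n * ∏ n square ^ ν
      ≈⟨ *-cong (^-cong n n≈-½) ∏square^ν ⟩
    (- ½) ^ n * - (-1ℤ ^ n)
      ≡⟨ cong (_* - (-1ℤ ^ n)) (trans (cong (_^ n) (sym (ℤ.-1*i≡-i ½))) (^-distribʳ-* -1ℤ ½ n)) ⟩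
    -1ℤ ^ n * ½ ^ n * - (-1ℤ ^ n)
      ≡⟨ solve 2 (λ s h → s :* h :* (:- s) := :- (h :* (s :* s))) refl (-1ℤ ^ n) (½ ^ n) ⟩
    - (½ ^ n * (-1ℤ ^ n * -1ℤ ^ n))
      ≡⟨ cong -_ (trans (cong (½ ^ n *_) (-1^n*-1^n n)) (ℤ.*-identityʳ (½ ^ n))) ⟩
    - (½ ^ n)
      ∎
    where open ≈-Reasoning

  module _ (e : ℤ) (eⁿ≈-1 : e ^ n ≈ -1ℤ) where

    entry : Matrix n n
    entry i j = square (toℕ i) - e * square (toℕ j)

    [e*square]^n : ∀ (j : Fin n) → (e * square (toℕ j)) ^ n ≈ -1ℤ
    [e*square]^n j = ≈-trans (≈-reflexive (^-distribʳ-* e (square (toℕ j)) n)) (*-cong eⁿ≈-1 (square^n≈1 (Fin.toℕ<n j)))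

    inverse₁ : ∀ x y → x ^ n ≈ 1ℤ → y ^ n ≈ -1ℤ → (x - y) * (½ * geometric n x y) ≈ 1ℤ
    inverse₁ x y xⁿ yⁿ = reduce₃ ½ (- ½) 1ℤ eq xⁿ yⁿ 2½≈1
      where
      eq : (x - y) * (½ * geometric n x y) - 1ℤ ≡ ½ * (x ^ n - 1ℤ) + - ½ * (y ^ n - -1ℤ) + 1ℤ * (+ 2 * ½ - 1ℤ)
      eq = begin
        (x - y) * (½ * geometric n x y) - 1ℤ
          ≡⟨ solve 3 (λ u h G → u :* (h :* G) :- con 1ℤ := h :* (u :* G) :- con 1ℤ) refl (x - y) ½ (geometric n x y) ⟩
        ½ * ((x - y) * geometric n x y) - 1ℤ
          ≡⟨ cong (λ t → ½ * t - 1ℤ) (geometric-telescopes n x y) ⟩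
        ½ * (x ^ n - y ^ n) - 1ℤ
          ≡⟨ solve 3 (λ h X Y → h :* (X :- Y) :- con 1ℤ := h :* (X :- con 1ℤ) :+ (:- h) :* (Y :- con -1ℤ) :+ con 1ℤ :* (con (+ 2) :* h :- con 1ℤ))
               refl ½ (x ^ n) (y ^ n) ⟩
        ½ * (x ^ n - 1ℤ) + - ½ * (y ^ n - -1ℤ) + 1ℤ * (+ 2 * ½ - 1ℤ)
          ∎
        where open ≡-Reasoning

    -- The constant is forced. If xⁿ = 1 and yⁿ = -1, multiplying the sum with coefficients c + 2i
    -- twice by x - y gives 4y + (2n + 2c)(x - y). For c = 2 - n this is 4x, and x^(n-1) · 4x = 4.
    weight : ℕ → ℤ
    weight = arithmetic (+ 2 - + n)

    -- The square of the geometric sum, reduced by yⁿ = -1 to degree < n in y.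
    inverse₂ : ∀ x y → x ^ n ≈ 1ℤ → y ^ n ≈ -1ℤ →
               (x - y) * (x - y) * (½ * ½ * x ^ ν * homogeneous weight n x y) ≈ 1ℤ
    -- The first two coefficients collect what multiplies xⁿ - 1 and yⁿ + 1 after telescoping twice.
    -- What is left is 4·½² - 1 = (2·½ + 1)(2·½ - 1).
    inverse₂ x y xⁿ yⁿ = reduce₃ (½ * ½ * V * (+ 2 * y + (x - y) * c) + + 4 * (½ * ½))
        (½ * ½ * V * (- (+ 2 * y) - + 2 * (+ n * (x - y)) - c * (x - y))) (+ 2 * ½ + 1ℤ) eq xⁿ yⁿ 2½≈1
      where
      open ≡-Reasoning
      V = x ^ ν
      Y = y ^ n
      G = geometric n x y
      H = homogeneous weight n x y
      c = + 2 - + n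
      eq : (x - y) * (x - y) * (½ * ½ * V * H) - 1ℤ ≡
           (½ * ½ * V * (+ 2 * y + (x - y) * c) + + 4 * (½ * ½)) * (x ^ n - 1ℤ)
           + (½ * ½ * V * (- (+ 2 * y) - + 2 * (+ n * (x - y)) - c * (x - y))) * (Y - -1ℤ)
           + (+ 2 * ½ + 1ℤ) * (+ 2 * ½ - 1ℤ)
      eq = begin
        (x - y) * (x - y) * (½ * ½ * V * H) - 1ℤ
          ≡⟨ solve 4 (λ u h V H → u :* u :* (h :* h :* V :* H) :- con 1ℤ := h :* h :* V :* (u :* (u :* H)) :- con 1ℤ)
               refl (x - y) ½ V H ⟩
        ½ * ½ * V * ((x - y) * ((x - y) * H)) - 1ℤ
          ≡⟨ cong (λ t → ½ * ½ * V * ((x - y) * t) - 1ℤ) (arithmetic-telescopes c n x y) ⟩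
        ½ * ½ * V * ((x - y) * (+ 2 * (y * G) - + 2 * (+ n * Y) + c * (x ^ n - Y))) - 1ℤ
          ≡⟨ solve 8 (λ u h V y G k Y T → h :* h :* V :* (u :* (con (+ 2) :* (y :* G) :- con (+ 2) :* (k :* Y) :+ T)) :- con 1ℤ
                := h :* h :* V :* (con (+ 2) :* (y :* (u :* G)) :- con (+ 2) :* (k :* u :* Y) :+ u :* T) :- con 1ℤ)
               refl (x - y) ½ V y G (+ n) Y (c * (x ^ n - Y)) ⟩
        ½ * ½ * V * (+ 2 * (y * ((x - y) * G)) - + 2 * (+ n * (x - y) * Y) + (x - y) * (c * (x ^ n - Y))) - 1ℤ
          ≡⟨ cong (λ t → ½ * ½ * V * (+ 2 * (y * t) - + 2 * (+ n * (x - y) * Y) + (x - y) * (c * (x ^ n - Y))) - 1ℤ)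
               (geometric-telescopes n x y) ⟩
        ½ * ½ * V * (+ 2 * (y * (x ^ n - Y)) - + 2 * (+ n * (x - y) * Y) + (x - y) * (c * (x ^ n - Y))) - 1ℤ
          ≡⟨ solve 6 (λ x y h V Y k →
               h :* h :* V :* (con (+ 2) :* (y :* (x :* V :- Y)) :- con (+ 2) :* (k :* (x :- y) :* Y)
                 :+ (x :- y) :* ((con (+ 2) :- k) :* (x :* V :- Y))) :- con 1ℤ
               := (h :* h :* V :* (con (+ 2) :* y :+ (x :- y) :* (con (+ 2) :- k)) :+ con (+ 4) :* (h :* h)) :* (x :* V :- con 1ℤ)
                  :+ (h :* h :* V :* (:- (con (+ 2) :* y) :- con (+ 2) :* (k :* (x :- y)) :- (con (+ 2) :- k) :* (x :- y))) :* (Y :- con -1ℤ)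
                  :+ (con (+ 2) :* h :+ con 1ℤ) :* (con (+ 2) :* h :- con 1ℤ)) refl x y ½ V Y (+ n) ⟩
        _ ∎

    powers : ℤ
    powers = ∏ n (e ^_)

    det-inverse₁ : (N : Matrix n n) → (∀ i j → entry i j * N i j ≈ 1ℤ) → ∥ N ∥ ≈ - powers
    det-inverse₁ N inv = begin
      ∥ N ∥
        ≈⟨ det-cong (λ i j → ≈-trans
             (inverse-unique {entry i j} (inv i j) (inverse₁ (square (toℕ i)) (e * square (toℕ j)) (square^n≈1 (Fin.toℕ<n i)) ([e*square]^n j)))
             (*-cong (≈-refl {½}) (≈-reflexive (sym (homogeneous-scale (λ _ → 1ℤ) e n (square (toℕ i)) (square (toℕ j))))))) ⟩
      ∥ (λ i j → ½ * homogeneous (λ k → 1ℤ * e ^ k) n (square (toℕ i)) (square (toℕ j))) ∥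
        ≈⟨ det-homogeneous n (λ _ → ½) (λ k → 1ℤ * e ^ k) square squares-orthogonal ⟩
      ∏ n (λ _ → ½) * (∏ n (λ k → 1ℤ * e ^ k) * ∏ n (λ i → + n * square i ^ ν))
        ≈⟨ *-cong (≈-reflexive (∏-const n ½)) (*-cong (≈-reflexive (∏-cong n λ {k} _ → ℤ.*-identityˡ (e ^ k))) ∏-diagonal) ⟩
      ½ ^ n * (powers * - (½ ^ n))
        ≈⟨ reduce₁ (- powers) (solve 2 (λ h T → h :* (T :* (:- h)) :- (:- T) := (:- T) :* (h :* h :- con 1ℤ)) refl (½ ^ n) powers) ½^n*½^n≈1 ⟩
      - powers
        ∎
      where open ≈-Reasoning

    -- The rows now carry ½² x^(n-1) instead of ½. Their constants multiply to ½^(2n) = 1, so the ½ⁿ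
    -- of the diagonal product survives, and the product of the x^(n-1) supplies the sign.
    det-inverse₂ : (N : Matrix n n) → (∀ i j → entry i j * entry i j * N i j ≈ 1ℤ) →
                   ∥ N ∥ ≈ -1ℤ ^ n * (∏ n weight * powers * ½ ^ n)
    det-inverse₂ N inv = begin
      ∥ N ∥
        ≈⟨ det-cong (λ i j → ≈-trans
             (inverse-unique {entry i j * entry i j} (inv i j) (inverse₂ (square (toℕ i)) (e * square (toℕ j)) (square^n≈1 (Fin.toℕ<n i)) ([e*square]^n j)))
             (*-cong (≈-refl {r (toℕ i)}) (≈-reflexive (sym (homogeneous-scale weight e n (square (toℕ i)) (square (toℕ j))))))) ⟩
      ∥ (λ i j → r (toℕ i) * homogeneous (λ k → weight k * e ^ k) n (square (toℕ i)) (square (toℕ j))) ∥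
        ≈⟨ det-homogeneous n r (λ k → weight k * e ^ k) square squares-orthogonal ⟩
      ∏ n r * (∏ n (λ k → weight k * e ^ k) * ∏ n (λ i → + n * square i ^ ν))
        ≡⟨ cong₂ (λ R W → R * (W * ∏ n (λ i → + n * square i ^ ν)))
             (trans (∏-* n (λ _ → ½ * ½) (λ i → square i ^ ν)) (cong₂ _*_ (trans (∏-const n (½ * ½)) (^-distribʳ-* ½ ½ n)) (∏-^ n square ν)))
             (∏-* n weight (e ^_)) ⟩
      ½ ^ n * ½ ^ n * ∏ n square ^ ν * (∏ n weight * powers * ∏ n (λ i → + n * square i ^ ν))
        ≈⟨ *-cong (*-cong ½^n*½^n≈1 ∏square^ν) (*-cong (≈-refl {∏ n weight * powers}) ∏-diagonal) ⟩
      1ℤ * - (-1ℤ ^ n) * (∏ n weight * powers * - (½ ^ n))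
        ≡⟨ solve 4 (λ s W T h → con 1ℤ :* (:- s) :* (W :* T :* (:- h)) := s :* (W :* T :* h)) refl (-1ℤ ^ n) (∏ n weight) powers (½ ^ n) ⟩
      -1ℤ ^ n * (∏ n weight * powers * ½ ^ n)
        ∎
      where
      open ≈-Reasoning
      r : ℕ → ℤ
      r i = ½ * ½ * square i ^ ν

-- The products for p ≡ 1 and p ≡ 3 (mod 4)

-1^even : ∀ m → -1ℤ ^ (m ℕ.+ m) ≡ 1ℤ
-1^even m = trans (ℤ.^-distribˡ-+-* -1ℤ m m) (-1^n*-1^n m)

module Evaluation (p ν : ℕ) (p-prime : Prime p) (p≡1+2n : p ≡ suc (suc ν ℕ.+ suc ν)) where
  open InverseDeterminants p ν p-prime p≡1+2n public
  open ≈-Reasoning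

  -- (1 + i)² = 2i for a square root i of -1.
  2^n-even : ∀ m i → n ≡ m ℕ.+ m → i * i ≈ -1ℤ → (+ 2) ^ n ≈ -1ℤ ^ m
  2^n-even m i n≡2m i²≈-1 = begin
    (+ 2) ^ n              ≡⟨ trans (cong ((+ 2) ^ n *_) (-1^n*-1^n m)) (ℤ.*-identityʳ ((+ 2) ^ n)) ⟨
    (+ 2) ^ n * (s * s)    ≡⟨ ℤ.*-assoc ((+ 2) ^ n) s s ⟨
    (+ 2) ^ n * s * s      ≈⟨ *-cong 2^n*s≈1 (≈-refl {s}) ⟩
    1ℤ * s                 ≡⟨ ℤ.*-identityˡ s ⟩
    s                      ∎
    where
    s = -1ℤ ^ m

    1+i≉0 : ¬ 1ℤ + i ≈ 0ℤ
    1+i≉0 1+i≈0 = 2≉0 (reduce₂ 1ℤ (1ℤ - i)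
      (solve 1 (λ i → con (+ 2) :- con 0ℤ := con 1ℤ :* (i :* i :- con -1ℤ) :+ (con 1ℤ :- i) :* (con 1ℤ :+ i :- con 0ℤ)) refl i)
      i²≈-1 1+i≈0)

    i^n≈s : i ^ n ≈ s
    i^n≈s = ≈-trans (≈-reflexive (trans (cong (i ^_) n≡2m) (^-double i m))) (^-cong m i²≈-1)

    2i≈[1+i]² : + 2 * i ≈ (1ℤ + i) * (1ℤ + i)
    2i≈[1+i]² = reduce₁ -1ℤ (solve 1 (λ i → con (+ 2) :* i :- (con 1ℤ :+ i) :* (con 1ℤ :+ i)
                                         := con -1ℤ :* (i :* i :- con -1ℤ)) refl i) i²≈-1

    2^n*s≈1 : (+ 2) ^ n * s ≈ 1ℤ
    2^n*s≈1 = begin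
      (+ 2) ^ n * s                ≈⟨ *-cong (≈-refl {(+ 2) ^ n}) i^n≈s ⟨
      (+ 2) ^ n * i ^ n            ≡⟨ ^-distribʳ-* (+ 2) i n ⟨
      (+ 2 * i) ^ n                ≈⟨ ^-cong {+ 2 * i} {(1ℤ + i) * (1ℤ + i)} n 2i≈[1+i]² ⟩
      ((1ℤ + i) * (1ℤ + i)) ^ n    ≡⟨ ^-double (1ℤ + i) n ⟨
      (1ℤ + i) ^ (n ℕ.+ n)         ≈⟨ fermat′ (1ℤ + i) 1+i≉0 ⟩
      1ℤ                           ∎

  -- Gauss's lemma: modulo p the even numbers between n and p are the
  -- negatives of the odd numbers up to n.
  2^n-odd : ∀ m → n ≡ suc (m ℕ.+ m) → (+ 2) ^ n ≈ -1ℤ ^ suc m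
  2^n-odd m n≡1+2m = cancelˡ (factorial n) ((+ 2) ^ n) s (∏-≉0 n positive positive≉0) (begin
    factorial n * (+ 2) ^ n
      ≡⟨ ℤ.*-comm (factorial n) ((+ 2) ^ n) ⟩
    (+ 2) ^ n * factorial n
      ≡⟨ cong (_* factorial n) (∏-const n (+ 2)) ⟨
    ∏ n (λ _ → + 2) * factorial n
      ≡⟨ ∏-* n (λ _ → + 2) positive ⟨
    ∏ n (λ i → + 2 * + suc i)
      ≡⟨ ∏-cong n (λ {i} _ → solve 1 (λ x → con (+ 2) :* x := x :+ x) refl (+ suc i)) ⟩
    ∏ n even
      ≡⟨ cong (λ k → ∏ k even) n≡m+suc-m ⟩
    ∏ (m ℕ.+ suc m) even
      ≡⟨ ∏-split m (suc m) even ⟩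
    evenProduct m * ∏ (suc m) (λ i → even (m ℕ.+ i))
      ≡⟨ cong (evenProduct m *_) (∏-reverse (suc m) (λ i → even (m ℕ.+ i))) ⟩
    evenProduct m * ∏ (suc m) (λ i → even (m ℕ.+ (m ∸ i)))
      ≈⟨ *-cong (≈-refl {evenProduct m}) (∏-≈-cong (suc m) (λ {i} i<1+m → reflect i (ℕ.≤-pred i<1+m))) ⟩
    evenProduct m * ∏ (suc m) (λ i → -1ℤ * odd i)
      ≡⟨ cong (evenProduct m *_) (trans (∏-* (suc m) (λ _ → -1ℤ) odd) (cong (_* oddProduct (suc m)) (∏-const (suc m) -1ℤ))) ⟩
    evenProduct m * (s * oddProduct (suc m))
      ≡⟨ solve 3 (λ E s O → E :* (s :* O) := E :* O :* s) refl (evenProduct m) s (oddProduct (suc m)) ⟩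
    evenProduct m * oddProduct (suc m) * s
      ≡⟨ cong (_* s) (trans (cong factorial n≡1+2m) (factorial-odd m)) ⟨
    factorial n * s
      ∎)
    where
    s = -1ℤ ^ suc m

    n≡m+suc-m : n ≡ m ℕ.+ suc m
    n≡m+suc-m = trans n≡1+2m (sym (ℕ.+-suc m m))

    -- `K` stands for `m ∸ i`; as a variable it keeps truncated subtraction away from the ring
    -- solver.
    p≡ : ∀ M I K N → M ≡ I + K → N ≡ 1ℤ + (M + M) →
         (1ℤ + (M + K)) + (1ℤ + (M + K)) - -1ℤ * (1ℤ + (I + I)) ≡ 1ℤ * (1ℤ + (N + N) - 0ℤ)
    p≡ _ I K _ refl refl = solve 2 (λ I K →
      (con 1ℤ :+ ((I :+ K) :+ K)) :+ (con 1ℤ :+ ((I :+ K) :+ K)) :- con -1ℤ :* (con 1ℤ :+ (I :+ I))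
      := con 1ℤ :* (con 1ℤ :+ ((con 1ℤ :+ ((I :+ K) :+ (I :+ K))) :+ (con 1ℤ :+ ((I :+ K) :+ (I :+ K)))) :- con 0ℤ)) refl I K

    -- Here p = 4m + 3, so the even number 2(2m - i + 1) equals p - (2i + 1).
    reflect : ∀ i → i ≤ m → even (m ℕ.+ (m ∸ i)) ≈ -1ℤ * odd i
    reflect i i≤m = reduce₁ 1ℤ (p≡ (+ m) (+ i) (+ (m ∸ i)) (+ n) (cong +_ (sym (ℕ.m+[n∸m]≡n i≤m))) (cong +_ n≡1+2m)) 1+2n≈0

  -- By Euler's criterion the symbol depends only on the n-th power, so the symbol of the
  -- determinant can be compared with that of 2 through n-th powers.
  legendre-cong : ∀ {a b} → a ^ n ≈ b ^ n → legendre a p ≡ legendre b p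
  legendre-cong {a} {b} aⁿ≈bⁿ = legendre≡ (legendre-sign b) (≈-trans aⁿ≈bⁿ (≈-sym (legendre≈^n b)))

  module _ (d : ℤ) ([-d]^n≈-1 : (- d) ^ n ≈ -1ℤ) where
    private
      e = - d
      T = powers e [-d]^n≈-1
      W = ∏ n (weight e [-d]^n≈-1)

    module Even (m : ℕ) (n≡2m : n ≡ m ℕ.+ m) where
      e≡ : ∀ k → e ^ k ≡ -1ℤ ^ k * d ^ k
      e≡ k = trans (cong (_^ k) (sym (ℤ.-1*i≡-i d))) (^-distribʳ-* -1ℤ d k)

      -1^n≡1 : -1ℤ ^ n ≡ 1ℤ
      -1^n≡1 = trans (cong (-1ℤ ^_) n≡2m) (-1^even m)

      d^n≈-1 : d ^ n ≈ -1ℤ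
      d^n≈-1 = ≈-trans (≈-reflexive (sym (trans (e≡ n) (trans (cong (_* d ^ n) -1^n≡1) (ℤ.*-identityˡ (d ^ n)))))) [-d]^n≈-1

      d^m*d^m≈-1 : d ^ m * d ^ m ≈ -1ℤ
      d^m*d^m≈-1 = ≈-trans (≈-reflexive (sym (trans (cong (d ^_) n≡2m) (ℤ.^-distribˡ-+-* d m m)))) d^n≈-1

      -- `∏-powers-even` for e = -d yields T e^m = (eⁿ)^m = (-1)^m, and e^m differs from d^m by the
      -- same sign.
      T*d^m≈1 : T * d ^ m ≈ 1ℤ
      T*d^m≈1 = begin
        T * d ^ m
          ≡⟨ cong (T *_) (trans (cong (_* d ^ m) (-1^n*-1^n m)) (ℤ.*-identityˡ (d ^ m))) ⟨
        T * (s * s * d ^ m)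
          ≡⟨ solve 3 (λ T s D → T :* (s :* s :* D) := s :* (T :* (s :* D))) refl T s (d ^ m) ⟩
        s * (T * (s * d ^ m))
          ≡⟨ cong (s *_) (cong₂ _*_ (cong (λ k → ∏ k (e ^_)) n≡2m) (sym (e≡ m))) ⟩
        s * (∏ (m ℕ.+ m) (e ^_) * e ^ m)
          ≡⟨ cong (s *_) (trans (∏-powers-even e m) (cong (λ k → (e ^ k) ^ m) (sym n≡2m))) ⟩
        s * (e ^ n) ^ m
          ≈⟨ *-cong (≈-refl {s}) (^-cong m [-d]^n≈-1) ⟩
        s * s
          ≡⟨ -1^n*-1^n m ⟩
        1ℤ
          ∎
        where s = -1ℤ ^ m

      -T≈d^m : - T ≈ d ^ m
      -T≈d^m = reduce₂ (d ^ m) (- T)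
        (solve 2 (λ T D → (:- T) :- D := D :* (T :* D :- con 1ℤ) :+ (:- T) :* (D :* D :- con -1ℤ)) refl T (d ^ m))
        T*d^m≈1 d^m*d^m≈-1

      -- -T is congruent to d^m, which is a square root of -1 and thus serves as the i in
      -- `2^n-even`; its n-th power is (dⁿ)^m = (-1)^m.
      [-T]^n≈2^n : (- T) ^ n ≈ (+ 2) ^ n
      [-T]^n≈2^n = begin
        (- T) ^ n      ≈⟨ ^-cong { - T} {d ^ m} n -T≈d^m ⟩
        (d ^ m) ^ n    ≡⟨ ^-swap d m n ⟩
        (d ^ n) ^ m    ≈⟨ ^-cong m d^n≈-1 ⟩
        -1ℤ ^ m        ≈⟨ 2^n-even m (d ^ m) n≡2m d^m*d^m≈-1 ⟨
        (+ 2) ^ n      ∎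

      -- The factor 2 - n + 2i is zero at i = m - 1, an index in range because n > 0 forces m > 0.
      -- Hence the second determinant vanishes modulo `p` when p ≡ 1 (mod 4).
      W≡0 : W ≡ 0ℤ
      W≡0 = go m n≡2m
        where
        c+2k≡0 : ∀ N K → N ≡ (1ℤ + K) + (1ℤ + K) → (+ 2 - N) + (K + K) ≡ 0ℤ
        c+2k≡0 _ K refl = solve 1 (λ K → (con (+ 2) :- ((con 1ℤ :+ K) :+ (con 1ℤ :+ K))) :+ (K :+ K) := con 0ℤ) refl K
        go : ∀ m → n ≡ m ℕ.+ m → W ≡ 0ℤ
        go (suc k) n≡2m = ∏-zero n (weight e [-d]^n≈-1) {k}
          (ℕ.≤-trans (ℕ.m≤m+n (suc k) (suc k)) (ℕ.≤-reflexive (sym n≡2m))) (c+2k≡0 (+ n) (+ k) (cong +_ n≡2m))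

    module Odd (m : ℕ) (n≡1+2m : n ≡ suc (m ℕ.+ m)) where
      T≈ : T ≈ -1ℤ ^ m
      T≈ = ≈-trans (≈-reflexive (trans (cong (λ k → ∏ k (e ^_)) n≡1+2m)
                     (trans (∏-powers-odd e m) (cong (λ k → (e ^ k) ^ m) (sym n≡1+2m)))))
                   (^-cong m [-d]^n≈-1)

      -T≈ : - T ≈ -1ℤ ^ suc m
      -T≈ = ≈-trans (-‿cong T≈) (≈-reflexive (sym (ℤ.-1*i≡-i (-1ℤ ^ m))))

      -1^n≡-1 : -1ℤ ^ n ≡ -1ℤ
      -1^n≡-1 = trans (cong (-1ℤ ^_) n≡1+2m) (cong (-1ℤ *_) (-1^even m))

      [-T]^n≈2^n : (- T) ^ n ≈ (+ 2) ^ n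
      [-T]^n≈2^n = begin
        (- T) ^ n              ≈⟨ ^-cong { - T} { -1ℤ ^ suc m} n -T≈ ⟩
        (-1ℤ ^ suc m) ^ n      ≡⟨ ^-swap -1ℤ (suc m) n ⟩
        (-1ℤ ^ n) ^ suc m      ≡⟨ cong (_^ suc m) -1^n≡-1 ⟩
        -1ℤ ^ suc m            ≈⟨ 2^n-odd m n≡1+2m ⟨
        (+ 2) ^ n              ∎

      -- A square root of the second determinant: W = (-1)^m O² n with O the odd product, T = (-1)^m
      -- and n = -½, so that all signs cancel and O² ½^(n+1) remains, where n + 1 = 2(m + 1) is
      -- even.
      root : ℤ
      root = oddProduct m * ½ ^ suc m

      ½^2m+2 : ½ * ½ ^ n ≡ ½ ^ suc m * ½ ^ suc m
      ½^2m+2 = trans (cong (λ k → ½ * ½ ^ k) n≡1+2m)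
        (trans (cong (½ ^_) (cong suc (sym (ℕ.+-suc m m)))) (ℤ.^-distribˡ-+-* ½ (suc m) (suc m)))

      square-root : -1ℤ ^ n * (W * T * ½ ^ n) ≈ root * root
      square-root = begin
        -1ℤ ^ n * (W * T * ½ ^ n)
          ≡⟨ cong₂ (λ s w → s * (w * T * ½ ^ n)) -1^n≡-1 W≡ ⟩
        -1ℤ * (s * (O * O) * + n * T * ½ ^ n)
          ≈⟨ *-cong (≈-refl { -1ℤ}) (*-cong (*-cong (*-cong (≈-refl {s * (O * O)}) n≈-½) T≈) (≈-refl {½ ^ n})) ⟩
        -1ℤ * (s * (O * O) * - ½ * s * ½ ^ n)
          ≡⟨ solve 4 (λ s O h H → con -1ℤ :* (s :* (O :* O) :* (:- h) :* s :* H) := (s :* s) :* (O :* O :* (h :* H)))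
               refl s O ½ (½ ^ n) ⟩
        (s * s) * (O * O * (½ * ½ ^ n))
          ≡⟨ cong₂ (λ a b → a * (O * O * b)) (-1^n*-1^n m) ½^2m+2 ⟩
        1ℤ * (O * O * (½ ^ suc m * ½ ^ suc m))
          ≡⟨ solve 2 (λ O h → con 1ℤ :* (O :* O :* (h :* h)) := (O :* h) :* (O :* h)) refl O (½ ^ suc m) ⟩
        root * root
          ∎
        where
        s = -1ℤ ^ m
        O = oddProduct m
        W≡ : W ≡ s * (O * O) * + n
        W≡ = trans (cong (λ k → ∏ k (λ i → (+ 2 - + k) + (+ i + + i))) n≡1+2m)
          (trans (∏-odd-range m) (cong (λ k → s * (O * O) * + k) (sym n≡1+2m)))

      root≉0 : ¬ root ≈ 0ℤ
      root≉0 = *-≉0 (oddProduct m) (½ ^ suc m)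
        (∏-≉0 m odd λ k<m → positive≉0 (ℕ.<-trans (ℕ.+-mono-< k<m k<m) (ℕ.≤-reflexive (sym n≡1+2m))))
        (^-≉0 ½ (suc m) ½≉0)

      root²^n≈1 : (root * root) ^ n ≈ 1ℤ
      root²^n≈1 = ≈-trans (≈-reflexive (sym (^-double root n))) (fermat′ root root≉0)

      -- r + 1/4 = (4r + 1 - p)/4 = - (2(m - r) + 1)/2.
      quarter-product : ½ * ½ * ∏ m (λ r → (+ suc r + ½ * ½) ^ 2) ≈ root * root
      quarter-product = begin
        ½ * ½ * ∏ m (λ r → (+ suc r + ½ * ½) ^ 2)
          ≡⟨ cong (½ * ½ *_) (∏-^ m (λ r → + suc r + ½ * ½) 2) ⟩
        ½ * ½ * ∏ m (λ r → + suc r + ½ * ½) ^ 2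
          ≈⟨ *-cong (≈-refl {½ * ½}) (^-cong {∏ m (λ r → + suc r + ½ * ½)} {∏ m (λ r → - ½ * odd (m ∸ suc r))} 2 (∏-≈-cong m (λ {r} r<m → shift r r<m))) ⟩
        ½ * ½ * ∏ m (λ r → - ½ * odd (m ∸ suc r)) ^ 2
          ≡⟨ cong (λ t → ½ * ½ * t ^ 2) (trans (∏-* m (λ _ → - ½) (λ r → odd (m ∸ suc r)))
               (cong₂ _*_ (∏-const m (- ½)) (sym (∏-reverse m odd)))) ⟩
        ½ * ½ * ((- ½) ^ m * O) ^ 2
          ≡⟨ cong (λ t → ½ * ½ * (t * O) ^ 2) (trans (cong (_^ m) (sym (ℤ.-1*i≡-i ½))) (^-distribʳ-* -1ℤ ½ m)) ⟩
        ½ * ½ * (s * ½ ^ m * O) ^ 2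
          ≡⟨ solve 4 (λ h s H O → h :* h :* ((s :* H :* O) :* ((s :* H :* O) :* con 1ℤ)) := (s :* s) :* ((O :* (h :* H)) :* (O :* (h :* H))))
               refl ½ s (½ ^ m) O ⟩
        (s * s) * (root * root)
          ≡⟨ trans (cong (_* (root * root)) (-1^n*-1^n m)) (ℤ.*-identityˡ (root * root)) ⟩
        root * root
          ∎
        where
        s = -1ℤ ^ m
        O = oddProduct m

        -- Subtracting h²p, with p = 4(1 + R + K) + 3, leaves a polynomial that vanishes at h = 1/2;
        -- the last coefficient is its quotient by 2h - 1.
        identity : ∀ h R K M N → M ≡ (1ℤ + R) + K → N ≡ 1ℤ + (M + M) →
                   ((1ℤ + R) + h * h) - - h * (1ℤ + (K + K)) ≡
                   h * h * (1ℤ + (N + N) - 0ℤ) + (- (1ℤ + + 3 * h) - R * (1ℤ + + 2 * h) - + 2 * h * K) * (+ 2 * h - 1ℤ)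
        identity h R K _ _ refl refl = solve 3 (λ h R K →
          ((con 1ℤ :+ R) :+ h :* h) :- (:- h) :* (con 1ℤ :+ (K :+ K)) :=
          h :* h :* (con 1ℤ :+ ((con 1ℤ :+ (((con 1ℤ :+ R) :+ K) :+ ((con 1ℤ :+ R) :+ K)))
                             :+ (con 1ℤ :+ (((con 1ℤ :+ R) :+ K) :+ ((con 1ℤ :+ R) :+ K)))) :- con 0ℤ)
          :+ (:- (con 1ℤ :+ con (+ 3) :* h) :- R :* (con 1ℤ :+ con (+ 2) :* h) :- con (+ 2) :* h :* K)
             :* (con (+ 2) :* h :- con 1ℤ)) refl h R K

        shift : ∀ r → r < m → + suc r + ½ * ½ ≈ - ½ * odd (m ∸ suc r)
        shift r r<m = reduce₂ (½ * ½) (- (1ℤ + + 3 * ½) - + r * (1ℤ + + 2 * ½) - + 2 * ½ * + (m ∸ suc r))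
          (identity ½ (+ r) (+ (m ∸ suc r)) (+ m) (+ n) (cong +_ (sym (ℕ.m+[n∸m]≡n r<m))) (cong +_ n≡1+2m)) 1+2n≈0 2½≈1

-- Rational numbers with denominator prime to p

ι : ℤ → ℚ
ι a = a / 1

toℚᵘ-/ : ∀ a d → toℚᵘ (a / suc d) ℚᵘ.≃ mkℚᵘ a d
toℚᵘ-/ a d = ℚ.toℚᵘ-fromℚᵘ (mkℚᵘ a d)

ι-* : ∀ a b → ι a ℚ.* ι b ≡ ι (a * b)
ι-* a b = ℚ.toℚᵘ-injective (ℚᵘ.≃-trans (ℚ.toℚᵘ-homo-* (ι a) (ι b))
  (ℚᵘ.≃-trans (ℚᵘ.*-cong (toℚᵘ-/ a 0) (toℚᵘ-/ b 0)) (ℚᵘ.≃-sym (toℚᵘ-/ (a * b) 0))))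

ι-+ : ∀ a b → ι a ℚ.+ ι b ≡ ι (a + b)
ι-+ a b = ℚ.toℚᵘ-injective (ℚᵘ.≃-trans (ℚ.toℚᵘ-homo-+ (ι a) (ι b))
  (ℚᵘ.≃-trans (ℚᵘ.+-cong (toℚᵘ-/ a 0) (toℚᵘ-/ b 0))
    (ℚᵘ.≃-trans (*≡* (solve 2 (λ a b → (a :* con 1ℤ :+ b :* con 1ℤ) :* con 1ℤ := (a :+ b) :* con 1ℤ) refl a b))
      (ℚᵘ.≃-sym (toℚᵘ-/ (a + b) 0)))))

ι-neg : ∀ a → ℚ.- ι a ≡ ι (- a)
ι-neg a = ℚ.toℚᵘ-injective (ℚᵘ.≃-trans (ℚ.toℚᵘ-homo‿- (ι a))
  (ℚᵘ.≃-trans (ℚᵘ.-‿cong (toℚᵘ-/ a 0)) (ℚᵘ.≃-sym (toℚᵘ-/ (- a) 0))))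

/-*-cancel : ∀ a d → (a / suc d) ℚ.* ι (+ suc d) ≡ ι a
/-*-cancel a d = ℚ.toℚᵘ-injective (ℚᵘ.≃-trans (ℚ.toℚᵘ-homo-* (a / suc d) (ι (+ suc d)))
  (ℚᵘ.≃-trans (ℚᵘ.*-cong (toℚᵘ-/ a d) (toℚᵘ-/ (+ suc d) 0))
    (ℚᵘ.≃-trans (*≡* (trans (solve 2 (λ a D → a :* D :* con 1ℤ := a :* (D :* con 1ℤ)) refl a (+ suc d))
                            (cong (a *_) (sym (ℤ.pos-* (suc d) 1)))))
      (ℚᵘ.≃-sym (toℚᵘ-/ a 0)))))

recip-inverse : ∀ u → u ≢ 0ℤ → recip u ℚ.* ι u ≡ 1ℚ
recip-inverse (+ zero)     u≢0 = ⊥-elim (u≢0 refl)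
recip-inverse (+ suc n)    u≢0 = /-*-cancel 1ℤ n
recip-inverse (ℤ.-[1+ n ]) u≢0 = begin
  (-1ℤ / suc n) ℚ.* ι (ℤ.-[1+ n ])          ≡⟨ cong ((-1ℤ / suc n) ℚ.*_) (ι-neg (+ suc n)) ⟨
  (-1ℤ / suc n) ℚ.* (ℚ.- ι (+ suc n))       ≡⟨ ℚ.neg-distribʳ-* (-1ℤ / suc n) (ι (+ suc n)) ⟨
  ℚ.- ((-1ℤ / suc n) ℚ.* ι (+ suc n))       ≡⟨ cong ℚ.-_ (/-*-cancel -1ℤ n) ⟩
  1ℚ                                        ∎
  where open ≡-Reasoning

ι-cancelʳ : ∀ {x y} u → u ≢ 0ℤ → x ℚ.* ι u ≡ y ℚ.* ι u → x ≡ y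
ι-cancelʳ {x} {y} u u≢0 eq = begin
  x                                ≡⟨ expand x ⟩
  x ℚ.* ι u ℚ.* recip u            ≡⟨ cong (ℚ._* recip u) eq ⟩
  y ℚ.* ι u ℚ.* recip u            ≡⟨ expand y ⟨
  y                                ∎
  where
  open ≡-Reasoning
  expand : ∀ z → z ≡ z ℚ.* ι u ℚ.* recip u
  expand z = sym (trans (ℚ.*-assoc z (ι u) (recip u))
    (trans (cong (z ℚ.*_) (trans (ℚ.*-comm (ι u) (recip u)) (recip-inverse u u≢0))) (ℚ.*-identityʳ z)))

clear-denominator : ∀ x t s → x ℚ.* ι t ≡ ι s → ℚ.↥ x * t ≡ s * ℚ.↧ x
clear-denominator x@(mkℚ n d _) t s eq = cleared
  (ℚᵘ.≃-trans (ℚᵘ.≃-sym (ℚᵘ.≃-trans (ℚ.toℚᵘ-homo-* x (ι t)) (ℚᵘ.*-cong (ℚᵘ.≃-refl {mkℚᵘ n d}) (toℚᵘ-/ t 0))))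
    (ℚᵘ.≃-trans (ℚ.toℚᵘ-cong eq) (toℚᵘ-/ s 0)))
  where
  cleared : (mkℚᵘ n d) ℚᵘ.* (mkℚᵘ t 0) ℚᵘ.≃ mkℚᵘ s 0 → n * t ≡ s * + suc d
  cleared (*≡* eq) = trans (sym (ℤ.*-identityʳ (n * t))) (trans eq (cong (λ k → s * + suc k) (ℕ.*-identityʳ d)))

module Localisation (p : ℕ) (p-prime : Prime p) where
  open PrimeModular p p-prime

  -- The reduced denominator divides numerator times t and is coprime to the numerator, so it
  -- divides t. A common divisor with p other than 1 would be p, which does not divide t.
  integral : ∀ x t s → ¬ t ≈ 0ℤ → x ℚ.* ι t ≡ ι s → Integralₚ p x
  integral x@(mkℚ n d c) t s t≉0 eq {k} (k∣d , k∣p) =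
    [ (λ k≡1 → k≡1) , (λ k≡p → ⊥-elim (t≉0 (∣⇒≈0 (∣ᵤ⇒∣ (ℕ.∣-trans (≡.subst (ℕ._∣ suc d) k≡p k∣d) d∣t))))) ]′
      (prime⇒irreducible p-prime k∣p)
    where
    d∣t : suc d ℕ.∣ ℤ.∣ t ∣
    d∣t = Coprimality.coprime-divisor (Coprimality.sym (Coprimality.recompute c))
      (ℕ.divides ℤ.∣ s ∣ (trans (sym (ℤ.abs-* n t)) (trans (cong ℤ.∣_∣ (clear-denominator x t s eq)) (ℤ.abs-* s (+ suc d)))))

  -- x ~ a: the class of x in the residue field is that of a.
  record _~_ (x : ℚ) (a : ℤ) : Set where
    constructor reduces
    field
      denom numer : ℤ
      denom≉0 : ¬ denom ≈ 0ℤ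
      cleared : x ℚ.* ι denom ≡ ι numer
      residue : numer ≈ a * denom

  ≉0⇒≢0 : ∀ {a} → ¬ a ≈ 0ℤ → a ≢ 0ℤ
  ≉0⇒≢0 a≉0 refl = a≉0 ≈-refl

  ι~ : ∀ a → ι a ~ a
  ι~ a = reduces 1ℤ a 1≉0 (trans (ι-* a 1ℤ) (cong ι (ℤ.*-identityʳ a))) (≈-reflexive (sym (ℤ.*-identityʳ a)))

  recip~ : ∀ u a → u * a ≈ 1ℤ → recip u ~ a
  recip~ u a ua≈1 = reduces u 1ℤ u≉0 (recip-inverse u (≉0⇒≢0 u≉0))
    (≈-trans (≈-sym ua≈1) (≈-reflexive (ℤ.*-comm u a)))
    where
    u≉0 : ¬ u ≈ 0ℤ
    u≉0 u≈0 = 1≉0 (≈-trans (≈-sym ua≈1) (*-cong {d = a} u≈0 ≈-refl))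

  module Q = ℚ.+-*-Solver

  -- The witnessing fractions need not be in lowest terms, so sums and products use the schoolbook
  -- formulas; the product of two denominators stays prime to p.
  ~-isRingRelation : IsRingRelation ℚ.+-*-rawRing (CommutativeRing.rawRing commutativeRing) _~_
  ~-isRingRelation = record
    { 0~0 = ι~ 0ℤ
    ; 1~1 = ι~ 1ℤ
    ; -~- = λ { {x} {a} (reduces t s t≉0 cl res) → reduces t (- s) t≉0
        (trans (sym (ℚ.neg-distribˡ-* x (ι t))) (trans (cong ℚ.-_ cl) (ι-neg s)))
        (reduce₁ -1ℤ (solve 3 (λ a s t → (:- s) :- (:- a) :* t := con -1ℤ :* (s :- a :* t)) refl a s t) res) }
    ; +~+ = λ { {x} {a} {y} {b} (reduces t s t≉0 cl res) (reduces t′ s′ t′≉0 cl′ res′) →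
        reduces (t * t′) (s * t′ + s′ * t) (*-≉0 t t′ t≉0 t′≉0)
          (begin
            (x ℚ.+ y) ℚ.* ι (t * t′)
              ≡⟨ cong ((x ℚ.+ y) ℚ.*_) (ι-* t t′) ⟨
            (x ℚ.+ y) ℚ.* (ι t ℚ.* ι t′)
              ≡⟨ Q.solve 4 (λ x y t t′ → (x Q.:+ y) Q.:* (t Q.:* t′) Q.:= x Q.:* t Q.:* t′ Q.:+ y Q.:* t′ Q.:* t) refl x y (ι t) (ι t′) ⟩
            x ℚ.* ι t ℚ.* ι t′ ℚ.+ y ℚ.* ι t′ ℚ.* ι t
              ≡⟨ cong₂ ℚ._+_ (trans (cong (ℚ._* ι t′) cl) (ι-* s t′)) (trans (cong (ℚ._* ι t) cl′) (ι-* s′ t)) ⟩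
            ι (s * t′) ℚ.+ ι (s′ * t)
              ≡⟨ ι-+ (s * t′) (s′ * t) ⟩
            ι (s * t′ + s′ * t)
              ∎)
          (reduce₂ t′ t (solve 6 (λ a b s t s′ t′ → (s :* t′ :+ s′ :* t) :- (a :+ b) :* (t :* t′)
             := t′ :* (s :- a :* t) :+ t :* (s′ :- b :* t′)) refl a b s t s′ t′) res res′) }
    ; *~* = λ { {x} {a} {y} {b} (reduces t s t≉0 cl res) (reduces t′ s′ t′≉0 cl′ res′) →
        reduces (t * t′) (s * s′) (*-≉0 t t′ t≉0 t′≉0)
          (begin
            (x ℚ.* y) ℚ.* ι (t * t′)
              ≡⟨ cong ((x ℚ.* y) ℚ.*_) (ι-* t t′) ⟨
            (x ℚ.* y) ℚ.* (ι t ℚ.* ι t′)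
              ≡⟨ Q.solve 4 (λ x y t t′ → (x Q.:* y) Q.:* (t Q.:* t′) Q.:= (x Q.:* t) Q.:* (y Q.:* t′)) refl x y (ι t) (ι t′) ⟩
            (x ℚ.* ι t) ℚ.* (y ℚ.* ι t′)
              ≡⟨ trans (cong₂ ℚ._*_ cl cl′) (ι-* s s′) ⟩
            ι (s * s′)
              ∎)
          (reduce₂ s′ (a * t) (solve 6 (λ a b s t s′ t′ → s :* s′ :- (a :* b) :* (t :* t′)
             := s′ :* (s :- a :* t) :+ (a :* t) :* (s′ :- b :* t′)) refl a b s t s′ t′) res res′) }
    }
    where open ≡-Reasoning

  -- For x = s/t and y = s′/t′ the numerator s t′ - s′ t of the difference is a multiple k p, and z
  -- is k/(t t′).
  ~⇒≈[mod] : ∀ {x y a b} → x ~ a → y ~ b → a ≈ b → x ≈ y [mod p ]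
  ~⇒≈[mod] {x} {y} {a} {b} (reduces t s t≉0 cl res) (reduces t′ s′ t′≉0 cl′ res′) a≈b =
    integral x t s t≉0 cl , integral y t′ s′ t′≉0 cl′ , z , integral z (t * t′) k tt′≉0 z*tt′≡k , x-y≡pz
    where
    open ≡-Reasoning
    tt′≉0 : ¬ t * t′ ≈ 0ℤ
    tt′≉0 = *-≉0 t t′ t≉0 t′≉0

    difference : s * t′ - s′ * t ≈ 0ℤ
    difference = reduce₃ t′ (- t) (t * t′) (solve 6 (λ a b s t s′ t′ → s :* t′ :- s′ :* t :- con 0ℤ
        := t′ :* (s :- a :* t) :+ (:- t) :* (s′ :- b :* t′) :+ (t :* t′) :* (a :- b)) refl a b s t s′ t′) res res′ a≈b

    k : ℤ
    k = _∣_.quotient (≈0⇒∣ difference)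

    z : ℚ
    z = ι k ℚ.* recip (t * t′)

    z*tt′≡k : z ℚ.* ι (t * t′) ≡ ι k
    z*tt′≡k = trans (ℚ.*-assoc (ι k) (recip (t * t′)) (ι (t * t′)))
      (trans (cong (ι k ℚ.*_) (recip-inverse (t * t′) (≉0⇒≢0 tt′≉0))) (ℚ.*-identityʳ (ι k)))

    x-y≡pz : x ℚ.- y ≡ ι (+ p) ℚ.* z
    x-y≡pz = ι-cancelʳ (t * t′) (≉0⇒≢0 tt′≉0) (begin
      (x ℚ.- y) ℚ.* ι (t * t′)
        ≡⟨ cong ((x ℚ.- y) ℚ.*_) (ι-* t t′) ⟨
      (x ℚ.- y) ℚ.* (ι t ℚ.* ι t′)
        ≡⟨ Q.solve 4 (λ x y t t′ → (x Q.:- y) Q.:* (t Q.:* t′) Q.:= x Q.:* t Q.:* t′ Q.:- y Q.:* t′ Q.:* t) refl x y (ι t) (ι t′) ⟩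
      x ℚ.* ι t ℚ.* ι t′ ℚ.- y ℚ.* ι t′ ℚ.* ι t
        ≡⟨ cong₂ ℚ._-_ (trans (cong (ℚ._* ι t′) cl) (ι-* s t′)) (trans (cong (ℚ._* ι t) cl′) (ι-* s′ t)) ⟩
      ι (s * t′) ℚ.- ι (s′ * t)
        ≡⟨ trans (cong (ι (s * t′) ℚ.+_) (ι-neg (s′ * t))) (ι-+ (s * t′) (- (s′ * t))) ⟩
      ι (s * t′ - s′ * t)
        ≡⟨ cong ι (_∣_.equality (≈0⇒∣ difference)) ⟩
      ι (k * + p)
        ≡⟨ trans (cong ι (ℤ.*-comm k (+ p))) (sym (ι-* (+ p) k)) ⟩
      ι (+ p) ℚ.* ι k
        ≡⟨ cong (ι (+ p) ℚ.*_) z*tt′≡k ⟨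
      ι (+ p) ℚ.* (z ℚ.* ι (t * t′))
        ≡⟨ ℚ.*-assoc (ι (+ p)) z (ι (t * t′)) ⟨
      ι (+ p) ℚ.* z ℚ.* ι (t * t′)
        ∎)

-- The two determinants

parity : ∀ n → ∃[ m ] (n ≡ m ℕ.+ m ⊎ n ≡ suc (m ℕ.+ m))
parity zero    = 0 , inj₁ refl
parity (suc n) with parity n
... | m , inj₁ refl = m , inj₂ refl
... | m , inj₂ refl = suc m , inj₁ (cong suc (sym (ℕ.+-suc m m)))

double : ∀ k → k ℕ.+ k ≡ k ℕ.* 2
double k = trans (cong (k ℕ.+_) (sym (ℕ.+-identityʳ k))) (ℕ.*-comm 2 k)

odd-prime : ∀ p → Prime p → 2 ∤ p → ∃[ ν ] (p ≡ suc (suc ν ℕ.+ suc ν) × half p ≡ suc ν)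
odd-prime p p-prime 2∤p = go (p ℕ./ 2) refl
  where
  p%2≡1 : p % 2 ≡ 1
  p%2≡1 = go (p % 2) refl (ℕ.m%n<n p 2)
    where
    go : ∀ r → r ≡ p % 2 → r < 2 → p % 2 ≡ 1
    go 0 r≡ _ = ⊥-elim (2∤p (ℕ.m%n≡0⇒n∣m p 2 (sym r≡)))
    go 1 r≡ _ = sym r≡
    go (suc (suc _)) _ (s≤s (s≤s ()))

  p≡ : ∀ h → h ≡ p ℕ./ 2 → p ≡ suc (h ℕ.* 2)
  p≡ h h≡ = trans (ℕ.m≡m%n+[m/n]*n p 2) (cong₂ (λ r q → r ℕ.+ q ℕ.* 2) p%2≡1 (sym h≡))

  go : ∀ h → h ≡ p ℕ./ 2 → ∃[ ν ] (p ≡ suc (suc ν ℕ.+ suc ν) × half p ≡ suc ν)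
  go zero    h≡ = ⊥-elim (¬prime[1] (≡.subst Prime (p≡ 0 h≡) p-prime))
  go (suc ν) h≡ = ν , trans (p≡ (suc ν) h≡) (cong suc (sym (double (suc ν)))) ,
    trans (cong half (p≡ (suc ν) h≡)) (ℕ.m*n/n≡m (suc ν) 2)

module Main (p ν : ℕ) (p-prime : Prime p) (p≡1+2n : p ≡ suc (suc ν ℕ.+ suc ν)) (half≡n : half p ≡ suc ν)
            (d : ℤ) (legendre≡-1 : legendre (- d) p ≡ -1ℤ) where
  open Evaluation p ν p-prime p≡1+2n
  open Localisation p p-prime
  open Determinant commutativeRing using (∥_∥; ∥∥≡det)

  [-d]^n≈-1 : (- d) ^ n ≈ -1ℤ
  [-d]^n≈-1 = ≈-trans (≈-sym (legendre≈^n (- d))) (≈-reflexive legendre≡-1)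

  T W : ℤ
  T = powers (- d) [-d]^n≈-1
  W = ∏ n (weight (- d) [-d]^n≈-1)

  Rₚ = CommutativeRing.rawRing commutativeRing

  form≡ : ∀ x y → x - - d * y ≡ x + d * y
  form≡ = solve 3 (λ d x y → x :- (:- d) :* y := x :+ d :* y) refl d

  -- The n-th powers of j² and -dk² are 1 and -1, so `inverse₁` exhibits an inverse of their
  -- difference.
  form≉0 : ∀ i j → ¬ form {p} d i j ≈ 0ℤ
  form≉0 i j form≈0 = 1≉0 (≈-trans (≈-sym (inverse₁ (- d) [-d]^n≈-1 x (- d * y) (square^n≈1 (i<n i)) [dy]^n≈-1))
    (*-cong {d = ½ * geometric n x (- d * y)} (≈-trans (≈-reflexive (form≡ x y)) form≈0) ≈-refl))
    where
    x = square (toℕ i)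
    y = square (toℕ j)
    i<n : ∀ (i : Fin (half p)) → toℕ i < n
    i<n i = ≡.subst (toℕ i <_) half≡n (Fin.toℕ<n i)
    [dy]^n≈-1 : (- d * y) ^ n ≈ -1ℤ
    [dy]^n≈-1 = ≈-trans (≈-reflexive (^-distribʳ-* (- d) y n)) (*-cong [-d]^n≈-1 (square^n≈1 (i<n j)))

  -- The exponents add up to p - 1. With m = 1 or 2 this makes the integer powers in `S` inverses of
  -- the denominators in `invDet`.
  power-inverse : ∀ m l → m ℕ.+ l ≡ n ℕ.+ n → ∀ i j → form {p} d i j ^ m * form {p} d i j ^ l ≈ 1ℤ
  power-inverse m l m+l≡2n i j = ≈-trans
    (≈-reflexive (trans (sym (ℤ.^-distribˡ-+-* f m l)) (cong (f ^_) m+l≡2n))) (fermat′ f (form≉0 i j))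
    where f = form {p} d i j

  -- `half p` equals n only propositionally; with the dimension as a variable the equation can be
  -- matched and the matrix needs no transport.
  det-inverses₁ : ∀ {k} → k ≡ n → (N : Fin k → Fin k → ℤ) →
    (∀ i j → (square (toℕ i) + d * square (toℕ j)) * N i j ≈ 1ℤ) → det Rₚ N ≈ - T
  det-inverses₁ refl N inv = ≈-trans (≈-reflexive (sym (∥∥≡det N)))
    (det-inverse₁ (- d) [-d]^n≈-1 N λ i j → ≈-trans (≈-reflexive (cong (_* N i j) (form≡ (square (toℕ i)) (square (toℕ j))))) (inv i j))

  det-inverses₂ : ∀ {k} → k ≡ n → (N : Fin k → Fin k → ℤ) →
    (∀ i j → (square (toℕ i) + d * square (toℕ j)) ^ 2 * N i j ≈ 1ℤ) → det Rₚ N ≈ -1ℤ ^ n * (W * T * ½ ^ n)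
  det-inverses₂ refl N inv = ≈-trans (≈-reflexive (sym (∥∥≡det N)))
    (det-inverse₂ (- d) [-d]^n≈-1 N λ i j → ≈-trans (≈-reflexive (cong (_* N i j)
      (trans (cong (λ t → t * t) (form≡ (square (toℕ i)) (square (toℕ j))))
        (cong ((square (toℕ i) + d * square (toℕ j)) *_) (sym (ℤ.*-identityʳ (square (toℕ i) + d * square (toℕ j)))))))) (inv i j))

  ≡-≈-isRingRelation : IsRingRelation ℤ.+-*-rawRing Rₚ _≈_
  ≡-≈-isRingRelation = record { 0~0 = ≈-refl ; 1~1 = ≈-refl ; -~- = -‿cong ; +~+ = +-cong ; *~* = *-cong }

  S≈det : ∀ m → S m d p ≈ det Rₚ (λ j k → form {p} d j k ^ m)
  S≈det m = IsRingRelation.det-rel ≡-≈-isRingRelation {half p}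
    {λ j k → form {p} d j k ^ m} {λ j k → form {p} d j k ^ m} (λ j k → ≈-refl)

  invDet~det : ∀ m l → m ℕ.+ l ≡ n ℕ.+ n → invDet m d p ~ det Rₚ (λ j k → form {p} d j k ^ l)
  invDet~det m l m+l≡2n = IsRingRelation.det-rel ~-isRingRelation {half p}
    {λ j k → recip (form {p} d j k ^ m)} {λ j k → form {p} d j k ^ l} (λ j k → recip~ (form {p} d j k ^ m) (form {p} d j k ^ l) (power-inverse m l m+l≡2n j k))

  p∸2≡ : p ∸ 2 ≡ ν ℕ.+ n
  p∸2≡ = cong (_∸ 2) p≡1+2n

  p∸3≡ : p ∸ 3 ≡ ν ℕ.+ ν
  p∸3≡ = trans (cong (_∸ 3) p≡1+2n) (cong (_∸ 1) (ℕ.+-suc ν ν))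

  1+[p∸2]≡2n : 1 ℕ.+ (p ∸ 2) ≡ n ℕ.+ n
  1+[p∸2]≡2n = cong suc p∸2≡

  2+[p∸3]≡2n : 2 ℕ.+ (p ∸ 3) ≡ n ℕ.+ n
  2+[p∸3]≡2n = trans (cong 2+ p∸3≡) (cong suc (sym (ℕ.+-suc ν ν)))

  det₁≈ : det Rₚ (λ j k → form {p} d j k ^ (p ∸ 2)) ≈ - T
  det₁≈ = det-inverses₁ half≡n (λ j k → form {p} d j k ^ (p ∸ 2)) λ j k →
    ≈-trans (≈-reflexive (cong (_* form {p} d j k ^ (p ∸ 2)) (sym (ℤ.*-identityʳ (form {p} d j k)))))
      (power-inverse 1 (p ∸ 2) 1+[p∸2]≡2n j k)

  det₂≈ : det Rₚ (λ j k → form {p} d j k ^ (p ∸ 3)) ≈ -1ℤ ^ n * (W * T * ½ ^ n)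
  det₂≈ = det-inverses₂ half≡n (λ j k → form {p} d j k ^ (p ∸ 3)) (power-inverse 2 (p ∸ 3) 2+[p∸3]≡2n)

  S₁≈ : S (p ∸ 2) d p ≈ - T
  S₁≈ = ≈-trans (S≈det (p ∸ 2)) det₁≈

  S₂≈ : S (p ∸ 3) d p ≈ -1ℤ ^ n * (W * T * ½ ^ n)
  S₂≈ = ≈-trans (S≈det (p ∸ 3)) det₂≈

  invDet₁≈ : ∀ {a} → - T ≈ a → invDet 1 d p ≈ a / 1 [mod p ]
  invDet₁≈ {a} -T≈a = ~⇒≈[mod] (invDet~det 1 (p ∸ 2) 1+[p∸2]≡2n) (ι~ a) (≈-trans det₁≈ -T≈a)

  legendre-S₁ : (- T) ^ n ≈ (+ 2) ^ n → legendre (S (p ∸ 2) d p) p ≡ legendre (+ 2) p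
  legendre-S₁ eq = legendre-cong (≈-trans (^-cong {S (p ∸ 2) d p} { - T} n S₁≈) eq)

  Claim : Set
  Claim =
    ( legendre (S (p ∸ 2) d p) p ≡ legendre (+ 2) p
    × (p % 4 ≡ 1 → invDet 1 d p ≈ (d ^ ((p ∸ 1) ℕ./ 4)) / 1 [mod p ])
    × (p % 4 ≡ 3 → invDet 1 d p ≈ (-1ℤ ^ ((p ℕ.+ 1) ℕ./ 4)) / 1 [mod p ])
    )
    ×
    ( legendre (S (p ∸ 3) d p) p / 1 ≡ (1ℤ - legendre -1ℤ p) / 2
    × (p % 4 ≡ 3 →
        invDet 2 d p ≈
          (+ 1 / 4) ℚ.* ∏₁ ((p ∸ 3) ℕ./ 4) (λ r → (+ r / 1 ℚ.+ + 1 / 4) ^ℚ 2)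
          [mod p ])
    )

  even-case : ∀ m → n ≡ m ℕ.+ m → Claim
  even-case m n≡2m =
    ( legendre-S₁ [-T]^n≈2^n
    , (λ _ → ≡.subst (λ k → invDet 1 d p ≈ (d ^ k) / 1 [mod p ]) (sym [p∸1]/4≡m) (invDet₁≈ -T≈d^m))
    , (λ p%4≡3 → ⊥-elim (p%4≢3 p%4≡3)))
    ,
    -- Once both symbols are evaluated, the two sides normalise to the same rational.
    ( trans (cong (_/ 1) legendre-S₂) (sym (cong (λ l → (1ℤ - l) / 2) legendre-neg1))
    , (λ p%4≡3 → ⊥-elim (p%4≢3 p%4≡3)))
    where
    open Even d [-d]^n≈-1 m n≡2m
    p≡1+4m : p ≡ 1 ℕ.+ m ℕ.* 4
    p≡1+4m = trans p≡1+2n (cong suc (trans (cong (λ k → k ℕ.+ k) n≡2m)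
      (N.solve 1 (λ m → (m N.:+ m) N.:+ (m N.:+ m) N.:= m N.:* N.con 4) refl m)))
      where module N = ℕ.+-*-Solver
    [p∸1]/4≡m : (p ∸ 1) ℕ./ 4 ≡ m
    [p∸1]/4≡m = trans (cong (λ k → (k ∸ 1) ℕ./ 4) p≡1+4m) (ℕ.m*n/n≡m m 4)
    p%4≢3 : p % 4 ≢ 3
    p%4≢3 p%4≡3 with () ← trans (sym p%4≡3) (trans (cong (_% 4) p≡1+4m) (ℕ.[m+kn]%n≡m%n 1 m 4))
    legendre-S₂ : legendre (S (p ∸ 3) d p) p ≡ 0ℤ
    legendre-S₂ = legendre≡ is-0 (^-cong {S (p ∸ 3) d p} {0ℤ} n (≈-trans S₂≈ (≈-reflexive
      (trans (cong (λ w → -1ℤ ^ n * (w * T * ½ ^ n)) W≡0) (ℤ.*-zeroʳ (-1ℤ ^ n))))))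
    legendre-neg1 : legendre -1ℤ p ≡ 1ℤ
    legendre-neg1 = legendre≡ is-1 (≈-reflexive -1^n≡1)

  odd-case : ∀ m → n ≡ suc (m ℕ.+ m) → Claim
  odd-case m n≡1+2m =
    ( legendre-S₁ [-T]^n≈2^n
    , (λ p%4≡1 → ⊥-elim (p%4≢1 p%4≡1))
    , (λ _ → ≡.subst (λ k → invDet 1 d p ≈ (-1ℤ ^ k) / 1 [mod p ]) (sym [p+1]/4≡1+m) (invDet₁≈ -T≈)))
    ,
    ( trans (cong (_/ 1) legendre-S₂) (sym (cong (λ l → (1ℤ - l) / 2) legendre-neg1))
    , (λ _ → ≡.subst (λ k → invDet 2 d p ≈ (+ 1 / 4) ℚ.* ∏₁ k (λ r → (+ r / 1 ℚ.+ + 1 / 4) ^ℚ 2) [mod p ])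
               (sym [p∸3]/4≡m)
               -- The determinant and the product are compared through their common residue
               -- `root * root`.
               (~⇒≈[mod] (invDet~det 2 (p ∸ 3) 2+[p∸3]≡2n) quarter-product~
                 (≈-trans (≈-trans det₂≈ square-root) (≈-sym quarter-product)))))
    where
    open Odd d [-d]^n≈-1 m n≡1+2m
    p≡3+4m : p ≡ 3 ℕ.+ m ℕ.* 4
    p≡3+4m = trans p≡1+2n (cong suc (trans (cong (λ k → k ℕ.+ k) n≡1+2m)
      (N.solve 1 (λ m → (N.con 1 N.:+ (m N.:+ m)) N.:+ (N.con 1 N.:+ (m N.:+ m)) N.:= N.con 2 N.:+ m N.:* N.con 4) refl m)))
      where module N = ℕ.+-*-Solver
    [p+1]/4≡1+m : (p ℕ.+ 1) ℕ./ 4 ≡ suc m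
    [p+1]/4≡1+m = trans (cong (ℕ._/ 4) (trans (cong (ℕ._+ 1) p≡3+4m) (ℕ.+-comm (3 ℕ.+ m ℕ.* 4) 1))) (ℕ.m*n/n≡m (suc m) 4)
    [p∸3]/4≡m : (p ∸ 3) ℕ./ 4 ≡ m
    [p∸3]/4≡m = trans (cong (λ k → (k ∸ 3) ℕ./ 4) p≡3+4m) (ℕ.m*n/n≡m m 4)
    p%4≢1 : p % 4 ≢ 1
    p%4≢1 p%4≡1 with () ← trans (sym p%4≡1) (trans (cong (_% 4) p≡3+4m) (ℕ.[m+kn]%n≡m%n 3 m 4))
    legendre-S₂ : legendre (S (p ∸ 3) d p) p ≡ 1ℤ
    legendre-S₂ = legendre≡ is-1 (≈-trans (^-cong {S (p ∸ 3) d p} {root * root} n (≈-trans S₂≈ square-root)) root²^n≈1)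
    legendre-neg1 : legendre -1ℤ p ≡ -1ℤ
    legendre-neg1 = legendre≡ is--1 (≈-reflexive -1^n≡-1)

    ¼~ : (+ 1 / 4) ~ (½ * ½)
    ¼~ = reduces (+ 4) 1ℤ (*-≉0 (+ 2) (+ 2) 2≉0 2≉0) refl
      (reduce₁ (- (+ 2 * ½ + 1ℤ)) (solve 1 (λ h → con 1ℤ :- h :* h :* con (+ 4)
        := (:- (con (+ 2) :* h :+ con 1ℤ)) :* (con (+ 2) :* h :- con 1ℤ)) refl ½) 2½≈1)

    open IsRingRelation ~-isRingRelation using (+~+; *~*; ^-rel; product-rel)
    open HomogeneousDeterminant p using (product≡∏)

    quarter-product~ : ((+ 1 / 4) ℚ.* ∏₁ m (λ r → (+ r / 1 ℚ.+ + 1 / 4) ^ℚ 2)) ~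
                       (½ * ½ * ∏ m (λ r → (+ suc r + ½ * ½) ^ 2))
    quarter-product~ = *~* ¼~ (≡.subst (∏₁ m (λ r → (+ r / 1 ℚ.+ + 1 / 4) ^ℚ 2) ~_)
      (product≡∏ m (λ r → (+ suc r + ½ * ½) ^ 2))
      (product-rel {m} {λ i → (+ suc (toℕ i) / 1 ℚ.+ + 1 / 4) ^ℚ 2} {λ i → (+ suc (toℕ i) + ½ * ½) ^ 2}
        λ i → ^-rel 2 (+~+ (ι~ (+ suc (toℕ i))) ¼~)))

  claim : Claim
  claim = [ even-case m , odd-case m ]′ (proj₂ (parity n))
    where m = proj₁ (parity n)

theorem1p2 : (p : ℕ) → Prime p → 2 ∤ p →
    (d : ℤ) → legendre (- d) p ≡ -1ℤ →
    ( legendre (S (p ∸ 2) d p) p ≡ legendre (+ 2) p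
    × (p % 4 ≡ 1 → invDet 1 d p ≈ (d ^ ((p ∸ 1) ℕ./ 4)) / 1 [mod p ])
    × (p % 4 ≡ 3 → invDet 1 d p ≈ (-1ℤ ^ ((p ℕ.+ 1) ℕ./ 4)) / 1 [mod p ])
    )
    ×
    ( legendre (S (p ∸ 3) d p) p / 1 ≡ (1ℤ - legendre -1ℤ p) / 2
    × (p % 4 ≡ 3 →
    invDet 2 d p ≈
    (+ 1 / 4) ℚ.* ∏₁ ((p ∸ 3) ℕ./ 4) (λ r → (+ r / 1 ℚ.+ + 1 / 4) ^ℚ 2)
    [mod p ])
    )
theorem1p2 p p-prime 2∤p d legendre≡-1 = Main.claim p ν p-prime p≡ half≡ d legendre≡-1
  where
  ν = proj₁ (odd-prime p p-prime 2∤p)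
  p≡ = proj₁ (proj₂ (odd-prime p p-prime 2∤p))
  half≡ = proj₂ (proj₂ (odd-prime p p-prime 2∤p))
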